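{- Let $G$ and $H$ be finite simple graphs with subsets $B_G\subseteq V(G)$ and $B_H\subseteq V(H)$, and let $f:G\to H$ be a surjective graph homomorphism such that $f(B_G)=B_H$. Then $$\zeta_G(B_G)\ge \zeta_H(B_H).$$
   Context: A graph homomorphism $f:G\to H$ is a map $f:V(G)\to V(H)$ such that $uv\in E(G)$ implies $f(u)f(v)\in E(H)$; it is surjective if it maps onto all of $V(H)$. For a finite simple graph $G$ and a subset $B\subseteq V(G)$, the $B$-restricted clique polynomial is $C_B(G;x)=\sum_{i=0}^{\omega(G[B])} c_i(B)x^i$, where $c_i(B)$ is the number of subsets $K\subseteq B$ with $|K|=i$ that are cliques in $G$; the empty set counts as a clique, so $c_0(B)=1$. Let $Z_B(G)=\{x<0 : C_B(G;x)=0\}$ (real $x$). If $Z_B(G)\neq\emptyset$, define $\zeta_G(B)=\max Z_B(G)$, the largest negative root of $C_B(G;x)$; if $Z_B(G)=\emptyset$, set $\zeta_G(B)=-\infty$. -}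

module Defs where

open import Algebra.Bundles using (RawSemiring)
import Algebra.Definitions.RawSemiring as RawSemiringDefinitions
open import Data.Fin.Base using (Fin; toℕ)
import Data.Fin.Properties as Fin
open import Data.Fin.Subset using (Subset; _∈_; _⊆_; ∣_∣; inside; outside)
open import Data.Fin.Subset.Properties using (_∈?_; _⊆?_)
open import Data.List.Base using (List; []; _∷_; _++_; map; filter; length)
open import Data.List.Extrema.Nat using (max)
open import Data.Nat.Base as ℕ using (ℕ; zero; suc)
import Data.Nat.Properties as ℕ
open import Data.Product.Base using (Σ; ∃; _×_; _,_)
open import Data.Rational.Base as ℚ using (ℚ; 0ℚ; 1ℚ; ½; _<_; _≤_; _+_; _*_; _-_; 1/_)
import Data.Rational.Properties as ℚ
open import Data.Rational.Solver using (module +-*-Solver)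
import Data.Vec.Base as Vec
open import Function.Bundles using (_⇔_)
open import Level using (0ℓ)
open import Relation.Binary.Core using (Rel)
open import Relation.Binary.Definitions using (Decidable; Symmetric; Irreflexive)
import Relation.Binary.Construct.Add.Infimum.NonStrict as AddInfimum
open import Relation.Binary.PropositionalEquality
  using (_≡_; _≢_; refl; sym; cong; subst; module ≡-Reasoning)
open import Relation.Nullary using (¬_; Dec)
open import Relation.Nullary.Construct.Add.Infimum using (_₋; ⊥₋; [_])
open import Relation.Nullary.Decidable using (_×-dec_; _→-dec_; ¬?)

------------------------------------------------------------------------
-- Real numbers: Cauchy sequences of rationals

IsCauchy : (ℕ → ℚ) → Set
IsCauchy s = ∀ ε → 0ℚ < ε →
  ∃ λ N → ∀ m n → N ℕ.≤ m → N ℕ.≤ n → ℚ.∣ s m - s n ∣ < ε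

record ℝ : Set where
  constructor mkℝ
  field
    seq    : ℕ → ℚ
    cauchy : IsCauchy seq

open ℝ public

infix 4 _≃ᴿ_ _<ᴿ_ _≤ᴿ_

_≃ᴿ_ : Rel ℝ 0ℓ
x ≃ᴿ y = ∀ ε → 0ℚ < ε →
  ∃ λ N → ∀ n → N ℕ.≤ n → ℚ.∣ seq x n - seq y n ∣ < ε

_<ᴿ_ : Rel ℝ 0ℓ
x <ᴿ y = Σ ℚ λ ε → 0ℚ < ε ×
  ∃ λ N → ∀ n → N ℕ.≤ n → seq x n + ε < seq y n

_≤ᴿ_ : Rel ℝ 0ℓ
x ≤ᴿ y = ¬ (y <ᴿ x)

module CauchyProperties where

  half-pos : ∀ {ε} → 0ℚ < ε → 0ℚ < ½ * ε
  half-pos {ε} 0<ε = subst (_< ½ * ε) (ℚ.*-zeroʳ ½) (ℚ.*-monoʳ-<-pos ½ 0<ε)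

  half+half : ∀ ε → ½ * ε + ½ * ε ≡ ε
  half+half ε = begin
    ½ * ε + ½ * ε ≡⟨ sym (ℚ.*-distribʳ-+ ε ½ ½) ⟩
    (½ + ½) * ε   ≡⟨ ℚ.*-identityˡ ε ⟩
    ε             ∎
    where open ≡-Reasoning

  const-cauchy : ∀ q → IsCauchy (λ _ → q)
  const-cauchy q ε 0<ε = 0 , λ _ _ _ _ →
    subst (λ r → ℚ.∣ r ∣ < ε) (sym (ℚ.+-inverseʳ q)) 0<ε

  +-cauchy : ∀ {s t} → IsCauchy s → IsCauchy t → IsCauchy (λ n → s n + t n)
  +-cauchy {s} {t} cs ct ε 0<ε with cs (½ * ε) (half-pos 0<ε) | ct (½ * ε) (half-pos 0<ε)
  ... | N₁ , h₁ | N₂ , h₂ = N₁ ℕ.⊔ N₂ , λ m n N≤m N≤n → begin-strict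
    ℚ.∣ (s m + t m) - (s n + t n) ∣       ≡⟨ cong ℚ.∣_∣ (rearrange (s m) (t m) (s n) (t n)) ⟩
    ℚ.∣ (s m - s n) + (t m - t n) ∣       ≤⟨ ℚ.∣p+q∣≤∣p∣+∣q∣ (s m - s n) (t m - t n) ⟩
    ℚ.∣ s m - s n ∣ + ℚ.∣ t m - t n ∣
      <⟨ ℚ.+-mono-< (h₁ m n (ℕ.m⊔n≤o⇒m≤o N₁ N₂ N≤m) (ℕ.m⊔n≤o⇒m≤o N₁ N₂ N≤n))
                    (h₂ m n (ℕ.m⊔n≤o⇒n≤o N₁ N₂ N≤m) (ℕ.m⊔n≤o⇒n≤o N₁ N₂ N≤n)) ⟩
    ½ * ε + ½ * ε                         ≡⟨ half+half ε ⟩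
    ε                                     ∎
    where
    open ℚ.≤-Reasoning
    rearrange : ∀ a b c d → (a + b) - (c + d) ≡ (a - c) + (b - d)
    rearrange = solve 4 (λ a b c d → (a :+ b) :- (c :+ d) := (a :- c) :+ (b :- d)) refl
      where open +-*-Solver

  eventually-bounded : ∀ {s} → IsCauchy s →
    Σ ℚ λ A → 0ℚ < A × ∃ λ N → ∀ n → N ℕ.≤ n → ℚ.∣ s n ∣ ≤ A
  eventually-bounded {s} cs with cs 1ℚ (ℚ.positive⁻¹ 1ℚ)
  ... | N , h = 1ℚ + ℚ.∣ s N ∣
    , ℚ.+-mono-<-≤ (ℚ.positive⁻¹ 1ℚ) (ℚ.0≤∣p∣ (s N))
    , N , λ n N≤n → begin
        ℚ.∣ s n ∣                     ≡⟨ cong ℚ.∣_∣ (split (s n) (s N)) ⟩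
        ℚ.∣ (s n - s N) + s N ∣       ≤⟨ ℚ.∣p+q∣≤∣p∣+∣q∣ (s n - s N) (s N) ⟩
        ℚ.∣ s n - s N ∣ + ℚ.∣ s N ∣   ≤⟨ ℚ.+-monoˡ-≤ ℚ.∣ s N ∣ (ℚ.<⇒≤ (h n N N≤n ℕ.≤-refl)) ⟩
        1ℚ + ℚ.∣ s N ∣                ∎
    where
    open ℚ.≤-Reasoning
    split : ∀ a b → a ≡ (a - b) + b
    split = solve 2 (λ a b → a := (a :- b) :+ b) refl
      where open +-*-Solver

  scale : ∀ {M ε} → 0ℚ < M → 0ℚ < ε → Σ ℚ λ δ → 0ℚ < δ × M * δ ≡ ε
  scale {M} {ε} 0<M 0<ε = 1/ M * ε
    , subst (_< 1/ M * ε) (ℚ.*-zeroʳ (1/ M)) (ℚ.*-monoʳ-<-pos (1/ M) 0<ε)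
    , (begin
        M * (1/ M * ε)   ≡⟨ sym (ℚ.*-assoc M (1/ M) ε) ⟩
        (M * 1/ M) * ε   ≡⟨ cong (_* ε) (ℚ.*-inverseʳ M) ⟩
        1ℚ * ε           ≡⟨ ℚ.*-identityˡ ε ⟩
        ε                ∎)
    where
    open ≡-Reasoning
    instance
      M-pos : ℚ.Positive M
      M-pos = ℚ.positive 0<M
      M-nonZero : ℚ.NonZero M
      M-nonZero = ℚ.pos⇒nonZero M
      1/M-pos : ℚ.Positive (1/ M)
      1/M-pos = ℚ.1/pos⇒pos M

  bound-* : ∀ {A p q δ} → 0ℚ < A → ℚ.∣ p ∣ ≤ A → ℚ.∣ q ∣ < δ → ℚ.∣ p * q ∣ < A * δ
  bound-* {A} {p} {q} {δ} 0<A p≤A q<δ = begin-strict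
    ℚ.∣ p * q ∣         ≡⟨ ℚ.∣p*q∣≡∣p∣*∣q∣ p q ⟩
    ℚ.∣ p ∣ * ℚ.∣ q ∣   ≤⟨ ℚ.*-monoʳ-≤-nonNeg ℚ.∣ q ∣ {{ℚ.nonNegative (ℚ.0≤∣p∣ q)}} p≤A ⟩
    A * ℚ.∣ q ∣         <⟨ ℚ.*-monoʳ-<-pos A {{ℚ.positive 0<A}} q<δ ⟩
    A * δ               ∎
    where open ℚ.≤-Reasoning

  ∣ab-cd∣-bound : ∀ {A B δ} a b c d → 0ℚ < A → 0ℚ < B → ℚ.∣ a ∣ ≤ A → ℚ.∣ d ∣ ≤ B →
    ℚ.∣ b - d ∣ < δ → ℚ.∣ a - c ∣ < δ → ℚ.∣ a * b - c * d ∣ < (A + B) * δ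
  ∣ab-cd∣-bound {A} {B} {δ} a b c d 0<A 0<B a≤A d≤B b-d<δ a-c<δ = begin-strict
    ℚ.∣ a * b - c * d ∣                       ≡⟨ cong ℚ.∣_∣ (rearrange a b c d) ⟩
    ℚ.∣ a * (b - d) + d * (a - c) ∣           ≤⟨ ℚ.∣p+q∣≤∣p∣+∣q∣ (a * (b - d)) (d * (a - c)) ⟩
    ℚ.∣ a * (b - d) ∣ + ℚ.∣ d * (a - c) ∣
      <⟨ ℚ.+-mono-< (bound-* {A} {a} {b - d} 0<A a≤A b-d<δ) (bound-* {B} {d} {a - c} 0<B d≤B a-c<δ) ⟩
    A * δ + B * δ                             ≡⟨ sym (ℚ.*-distribʳ-+ δ A B) ⟩
    (A + B) * δ                               ∎
    where
    open ℚ.≤-Reasoning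
    rearrange : ∀ a b c d → a * b - c * d ≡ a * (b - d) + d * (a - c)
    rearrange = solve 4 (λ a b c d →
      a :* b :- c :* d := a :* (b :- d) :+ d :* (a :- c)) refl
      where open +-*-Solver

  *-cauchy : ∀ {s t} → IsCauchy s → IsCauchy t → IsCauchy (λ n → s n * t n)
  *-cauchy {s} {t} cs ct ε 0<ε =
    let A , 0<A , N₁ , bs = eventually-bounded cs
        B , 0<B , N₂ , bt = eventually-bounded ct
        δ , 0<δ , eq      = scale {A + B} (ℚ.+-mono-< 0<A 0<B) 0<ε
        N₃ , hs           = cs δ 0<δ
        N₄ , ht           = ct δ 0<δ
    in combine A B δ N₁ N₂ N₃ N₄ 0<A 0<B eq bs bt hs ht
    where
    combine : ∀ A B δ N₁ N₂ N₃ N₄ → 0ℚ < A → 0ℚ < B → (A + B) * δ ≡ ε →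
      (∀ n → N₁ ℕ.≤ n → ℚ.∣ s n ∣ ≤ A) → (∀ n → N₂ ℕ.≤ n → ℚ.∣ t n ∣ ≤ B) →
      (∀ m n → N₃ ℕ.≤ m → N₃ ℕ.≤ n → ℚ.∣ s m - s n ∣ < δ) →
      (∀ m n → N₄ ℕ.≤ m → N₄ ℕ.≤ n → ℚ.∣ t m - t n ∣ < δ) →
      ∃ λ N → ∀ m n → N ℕ.≤ m → N ℕ.≤ n → ℚ.∣ s m * t m - s n * t n ∣ < ε
    combine A B δ N₁ N₂ N₃ N₄ 0<A 0<B eq bs bt hs ht =
      (N₁ ℕ.⊔ N₂) ℕ.⊔ (N₃ ℕ.⊔ N₄) , λ m n N≤m N≤n →
        let N₁₂≤m = ℕ.m⊔n≤o⇒m≤o (N₁ ℕ.⊔ N₂) (N₃ ℕ.⊔ N₄) N≤m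
            N₃₄≤m = ℕ.m⊔n≤o⇒n≤o (N₁ ℕ.⊔ N₂) (N₃ ℕ.⊔ N₄) N≤m
            N₁₂≤n = ℕ.m⊔n≤o⇒m≤o (N₁ ℕ.⊔ N₂) (N₃ ℕ.⊔ N₄) N≤n
            N₃₄≤n = ℕ.m⊔n≤o⇒n≤o (N₁ ℕ.⊔ N₂) (N₃ ℕ.⊔ N₄) N≤n
        in subst (ℚ.∣ s m * t m - s n * t n ∣ <_) eq
             (∣ab-cd∣-bound (s m) (t m) (s n) (t n) 0<A 0<B
               (bs m (ℕ.m⊔n≤o⇒m≤o N₁ N₂ N₁₂≤m))
               (bt n (ℕ.m⊔n≤o⇒n≤o N₁ N₂ N₁₂≤n))
               (ht m n (ℕ.m⊔n≤o⇒n≤o N₃ N₄ N₃₄≤m) (ℕ.m⊔n≤o⇒n≤o N₃ N₄ N₃₄≤n))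
               (hs m n (ℕ.m⊔n≤o⇒m≤o N₃ N₄ N₃₄≤m) (ℕ.m⊔n≤o⇒m≤o N₃ N₄ N₃₄≤n)))

open CauchyProperties

0ᴿ 1ᴿ : ℝ
0ᴿ = mkℝ (λ _ → 0ℚ) (const-cauchy 0ℚ)
1ᴿ = mkℝ (λ _ → 1ℚ) (const-cauchy 1ℚ)

infixl 6 _+ᴿ_
infixl 7 _*ᴿ_

_+ᴿ_ : ℝ → ℝ → ℝ
x +ᴿ y = mkℝ (λ n → seq x n + seq y n) (+-cauchy {seq x} {seq y} (cauchy x) (cauchy y))

_*ᴿ_ : ℝ → ℝ → ℝ
x *ᴿ y = mkℝ (λ n → seq x n * seq y n) (*-cauchy {seq x} {seq y} (cauchy x) (cauchy y))

ℝ-rawSemiring : RawSemiring 0ℓ 0ℓ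
ℝ-rawSemiring = record
  { Carrier = ℝ
  ; _≈_     = _≃ᴿ_
  ; _+_     = _+ᴿ_
  ; _*_     = _*ᴿ_
  ; 0#      = 0ᴿ
  ; 1#      = 1ᴿ
  }

-- The reals with -∞ adjoined; ⊥₋ is -∞ and [ x ] is the real number x.

ℝ₋∞ : Set
ℝ₋∞ = ℝ ₋

open AddInfimum _≤ᴿ_ public using () renaming (_≤₋_ to _≤₋∞_)

------------------------------------------------------------------------
-- Finite simple graphs

-- Adjacency is decidable so that cliques can be counted.

record Graph (n : ℕ) : Set₁ where
  field
    Edge   : Rel (Fin n) 0ℓ
    edge?  : Decidable Edge
    symm   : Symmetric Edge
    irrefl : Irreflexive _≡_ Edge

open Graph public

IsHomomorphism : ∀ {n m} → Graph n → Graph m → (Fin n → Fin m) → Set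
IsHomomorphism G H f = ∀ {u v} → Edge G u v → Edge H (f u) (f v)

-- f(A) = B

IsImage : ∀ {n m} → (Fin n → Fin m) → Subset n → Subset m → Set
IsImage f A B = ∀ v → v ∈ B ⇔ (∃ λ u → u ∈ A × f u ≡ v)

IsClique : ∀ {n} → Graph n → Subset n → Set
IsClique G K = ∀ u v → u ∈ K → v ∈ K → u ≢ v → Edge G u v

isClique? : ∀ {n} (G : Graph n) (K : Subset n) → Dec (IsClique G K)
isClique? G K = Fin.all? λ u → Fin.all? λ v →
  (u ∈? K) →-dec (v ∈? K) →-dec ¬? (u Fin.≟ v) →-dec edge? G u v

-- Every subset of Fin n, each listed exactly once.

subsets : ∀ n → List (Subset n)
subsets zero    = Vec.[] ∷ []
subsets (suc n) = map (outside Vec.∷_) (subsets n) ++ map (inside Vec.∷_) (subsets n)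

cliquesIn : ∀ {n} → Graph n → Subset n → List (Subset n)
cliquesIn G B = filter (λ K → (K ⊆? B) ×-dec isClique? G K) (subsets _)

-- The coefficient c_i(B).

cliqueCount : ∀ {n} → Graph n → Subset n → ℕ → ℕ
cliqueCount G B i = length (filter (λ K → ∣ K ∣ ℕ.≟ i) (cliquesIn G B))

-- ω(G[B]): the cliques of G[B] are the cliques of G contained in B.

cliqueNumber : ∀ {n} → Graph n → Subset n → ℕ
cliqueNumber G B = max 0 (map ∣_∣ (cliquesIn G B))

-- C_B(G;x), where k ×ᴿ y is the k-fold sum y + … + y.

open RawSemiringDefinitions ℝ-rawSemiring public
  using () renaming (_×_ to _×ᴿ_; _^_ to _^ᴿ_; sum to sumᴿ)

cliquePolynomial : ∀ {n} → Graph n → Subset n → ℝ → ℝ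
cliquePolynomial G B x =
  sumᴿ {suc (cliqueNumber G B)} λ i → cliqueCount G B (toℕ i) ×ᴿ (x ^ᴿ toℕ i)

-- x ∈ Z_B(G)

IsNegativeRoot : ∀ {n} → Graph n → Subset n → ℝ → Set
IsNegativeRoot G B x = x <ᴿ 0ᴿ × cliquePolynomial G B x ≃ᴿ 0ᴿ

-- The graph of ζ: Isζ G B z says ζ_G(B) = z.  Such a z is unique up to _≃ᴿ_,
-- and classically it always exists, Z_B(G) being finite.

Isζ : ∀ {n} → Graph n → Subset n → ℝ₋∞ → Set
Isζ G B ⊥₋    = ∀ x → ¬ IsNegativeRoot G B x
Isζ G B [ z ] = IsNegativeRoot G B z × (∀ x → IsNegativeRoot G B x → x ≤ᴿ z)

{-# OPTIONS --safe #-}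
-- Write P_S(y) for the S-restricted clique polynomial; it satisfies
-- P_S = P_{S-v} + y P_{S∩N(v)} for v ∈ S.  Call y ∈ [-1,0] good for B when
-- P_S(y) > 0 for all S ⊆ B.  By induction on ∣S∣ the recurrence shows that, at
-- a good y, adding edges and moving y towards 0 only increases the ratios
-- P_S / P_T for T ⊆ S, and so preserves positivity (as in Shearer's theorem on the
-- Lovász local lemma).  For B nonempty, -1 is bad and -1/2ⁿ is good, and
-- bisection between bad and good rationals converges to a root x of P_B: P_B ≤ P_S at a
-- good point, and some P_S is nonpositive at a nearby bad point.
-- Choosing one preimage in B_G of every vertex of B_H embeds a spanning
-- subgraph of H[B_H] in G[B_G], so the polynomial of H is bounded away from 0 on [y,0]
-- for every y that is good for B_G.  Were ζ_H > ζ_G ≥ x, some good y > x would lie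
-- below ζ_H, and ζ_H could not be a root.
module Submission where

open import Defs
import Algebra.Definitions.RawSemiring as RawSemiringDefinitions
import Algebra.Properties.CommutativeMonoid.Sum as CommutativeMonoidSum
import Algebra.Properties.Monoid.Mult as MonoidMult
open import Data.Bool.Base using (true; false; if_then_else_)
open import Data.Empty using (⊥-elim)
open import Data.Fin.Base using (Fin; zero; suc; toℕ)
import Data.Fin.Properties as Fin
open import Data.Fin.Subset
  using (Subset; _∈_; _∉_; _⊆_; ∣_∣; inside; outside; ⊥; ⁅_⁆; _∩_; _-_; Nonempty)
open import Data.Fin.Subset.Properties
import Data.Integer.Base as ℤ
import Data.Integer.Properties as ℤ
open import Data.List.Base using (List; []; _∷_; _++_; map; filter; length; foldr)
import Data.List.Extrema.Nat as Extrema
open import Data.List.Relation.Unary.All as All using (All; []; _∷_)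
import Data.List.Relation.Unary.All.Properties as All
open import Data.Nat.Base as ℕ using (ℕ; zero; suc; z≤n; s≤s)
import Data.Nat.Coprimality as ℕ
import Data.Nat.Induction as ℕ
import Data.Nat.ListAction as ListAction
import Data.Nat.Properties as ℕ
open import Data.Product.Base using (Σ; ∃; _×_; _,_; proj₁; proj₂)
open import Data.Rational.Base as ℚ using (ℚ; 0ℚ; 1ℚ; ½; _<_; _≤_; _+_; _*_)
  renaming (_-_ to _-ℚ_; -_ to -ℚ_)
import Data.Rational.Properties as ℚ
open import Data.Rational.Solver using (module +-*-Solver)
import Data.Rational.Unnormalised.Base as ℚᵘ
import Data.Rational.Unnormalised.Properties as ℚᵘ
open import Data.Sum.Base using (inj₁; inj₂)
open import Data.Vec.Base as Vec using (tabulate; lookup; _[_]≔_)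
import Data.Vec.Properties as Vec
open import Function.Base using (_∘_; const)
open import Function.Bundles using (_⇔_; mk⇔; Equivalence)
open import Function.Definitions using (Surjective)
open import Induction.WellFounded using (Acc; acc)
open import Level using (0ℓ)
open import Relation.Binary.Construct.Add.Infimum.NonStrict _≤ᴿ_
  using (⊥₋≤_) renaming ([_] to [_]≤)
open import Relation.Binary.PropositionalEquality
open import Relation.Nullary using (¬_; Dec; yes; no; does; contradiction)
open import Relation.Nullary.Construct.Add.Infimum using (⊥₋; [_])
open import Relation.Nullary.Decidable
  using (_×-dec_; ¬?; dec-true; dec-false; decidable-stable; does-⇔; from-yes)
open import Relation.Unary using (Pred; Decidable)

open RawSemiringDefinitions ℚ.+-*-rawSemiring
  using () renaming (_×_ to _×ℚ_; _^_ to _^ℚ_; sum to sumℚ)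
open MonoidMult ℚ.+-0-monoid using (×-homo-+; ×-assocˡ)
module ∑ = CommutativeMonoidSum ℚ.+-0-commutativeMonoid

variable
  n m : ℕ

-- Deletion, insertion and induction on finite subsets

x∈p-y⁻ : ∀ {x} (p : Subset n) y → x ∈ p - y → x ∈ p × x ≢ y
x∈p-y⁻ {x = x} p y x∈p-y = p─q⊆p p ⁅ y ⁆ x∈p-y , λ { refl → y∉p-y p y x∈p-y }
  where
  y∉p-y : ∀ {n} (p : Subset n) y → y ∉ p - y
  y∉p-y (_ Vec.∷ p) zero    ()
  y∉p-y (_ Vec.∷ p) (suc y) (Vec.there y∈) = y∉p-y p y y∈

∣p∣≡1+∣p-x∣ : ∀ (p : Subset n) {x} → x ∈ p → ∣ p ∣ ≡ suc ∣ p - x ∣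
∣p∣≡1+∣p-x∣ (inside  Vec.∷ p) {zero}  Vec.here        = cong (suc ∘ ∣_∣) (sym (p─⊥≡p p))
∣p∣≡1+∣p-x∣ (inside  Vec.∷ p) {suc x} (Vec.there x∈p) = cong suc (∣p∣≡1+∣p-x∣ p x∈p)
∣p∣≡1+∣p-x∣ (outside Vec.∷ p) {suc x} (Vec.there x∈p) = ∣p∣≡1+∣p-x∣ p x∈p

∣p[x]≔inside∣ : ∀ (p : Subset n) x → lookup p x ≡ outside → ∣ p [ x ]≔ inside ∣ ≡ suc ∣ p ∣
∣p[x]≔inside∣ (outside Vec.∷ p) zero    _  = refl
∣p[x]≔inside∣ (inside  Vec.∷ p) (suc x) eq = cong suc (∣p[x]≔inside∣ p x eq)
∣p[x]≔inside∣ (outside Vec.∷ p) (suc x) eq = ∣p[x]≔inside∣ p x eq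

⊆∧∄∈∖⇒≡ : ∀ {S T : Subset n} → T ⊆ S → ¬ (∃ λ v → v ∈ S × v ∉ T) → T ≡ S
⊆∧∄∈∖⇒≡ {S = S} {T} T⊆S ∄ = ⊆-antisym T⊆S S⊆T
  where
  S⊆T : S ⊆ T
  S⊆T {x} x∈S with x ∈? T
  ... | yes x∈T = x∈T
  ... | no  x∉T = contradiction (x , x∈S , x∉T) ∄

∖-nonempty? : ∀ (S T : Subset n) → Dec (∃ λ v → v ∈ S × v ∉ T)
∖-nonempty? S T = Fin.any? λ v → (v ∈? S) ×-dec ¬? (v ∈? T)

p⊆q∧x∉p⇒p⊆q-x : ∀ {S T : Subset n} {v} → T ⊆ S → v ∉ T → T ⊆ S - v
p⊆q∧x∉p⇒p⊆q-x T⊆S v∉T x∈T = x∈p∧x≢y⇒x∈p-y (T⊆S x∈T) λ { refl → v∉T x∈T }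

p-x⊆p : ∀ (S : Subset n) v → S - v ⊆ S
p-x⊆p S v x∈ = proj₁ (x∈p-y⁻ S v x∈)

-- In the applications the claim at `S` speaks of all subsets of `S`, so the hypothesis at `S - v`
-- covers every subset of `S` that avoids `v`.
removal-induction : ∀ {ℓ} (Q : Pred (Subset n) ℓ) →
  (∀ S → (∀ {v} → v ∈ S → Q (S - v)) → Q S) → ∀ S → Q S
removal-induction Q step S = go S (ℕ.<-wellFounded ∣ S ∣)
  where
  go : ∀ S → Acc ℕ._<_ ∣ S ∣ → Q S
  go S (acc rs) = step S λ v∈S → go _ (rs (x∈p⇒∣p-x∣<∣p∣ v∈S))

fromDec : {P : Pred (Fin n) 0ℓ} → Decidable P → Subset n
fromDec P? = tabulate (does ∘ P?)

module _ {P : Pred (Fin n) 0ℓ} (P? : Decidable P) where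

  ∈-fromDec⁺ : ∀ {x} → P x → x ∈ fromDec P?
  ∈-fromDec⁺ {x} px = Vec.lookup⇒[]= x _
    (trans (Vec.lookup∘tabulate (does ∘ P?) x) (dec-true (P? x) px))

  ∈-fromDec⁻ : ∀ {x} → x ∈ fromDec P? → P x
  ∈-fromDec⁻ {x} x∈ with P? x | trans (sym (Vec.lookup∘tabulate (does ∘ P?) x)) (Vec.[]=⇒lookup x∈)
  ... | yes px | _ = px

neighbours : Graph n → Fin n → Subset n
neighbours G v = fromDec (edge? G v)

-- Sums over lists and over all subsets

sumList : {A : Set} → (A → ℚ) → List A → ℚ
sumList f = foldr (λ a r → f a + r) 0ℚ

module _ {A : Set} where

  sumList-cong : ∀ {f g : A → ℚ} → (∀ a → f a ≡ g a) → ∀ L → sumList f L ≡ sumList g L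
  sumList-cong f≗g []      = refl
  sumList-cong f≗g (a ∷ L) = cong₂ _+_ (f≗g a) (sumList-cong f≗g L)

  sumList-zero : ∀ {f : A → ℚ} → (∀ a → f a ≡ 0ℚ) → ∀ L → sumList f L ≡ 0ℚ
  sumList-zero f≗0 []      = refl
  sumList-zero f≗0 (a ∷ L) = cong₂ _+_ (f≗0 a) (sumList-zero f≗0 L)

  sumList-++ : ∀ (f : A → ℚ) L L′ → sumList f (L ++ L′) ≡ sumList f L + sumList f L′
  sumList-++ f []      L′ = sym (ℚ.+-identityˡ _)
  sumList-++ f (a ∷ L) L′ = trans (cong (f a +_) (sumList-++ f L L′)) (sym (ℚ.+-assoc (f a) _ _))

  sumList-map : ∀ {B : Set} (f : A → ℚ) (h : B → A) L → sumList f (map h L) ≡ sumList (f ∘ h) L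
  sumList-map f h []      = refl
  sumList-map f h (a ∷ L) = cong (f (h a) +_) (sumList-map f h L)

  sumList-+ : ∀ (f g : A → ℚ) L → sumList (λ a → f a + g a) L ≡ sumList f L + sumList g L
  sumList-+ f g []      = refl
  sumList-+ f g (a ∷ L) = trans (cong (f a + g a +_) (sumList-+ f g L))
    (interchange (f a) (g a) (sumList f L) (sumList g L))
    where
    open +-*-Solver
    interchange : ∀ a b c d → (a + b) + (c + d) ≡ (a + c) + (b + d)
    interchange = solve 4 (λ a b c d → (a :+ b) :+ (c :+ d) := (a :+ c) :+ (b :+ d)) refl

  sumList-* : ∀ c (f : A → ℚ) L → sumList (λ a → c * f a) L ≡ c * sumList f L
  sumList-* c f []      = sym (ℚ.*-zeroʳ c)
  sumList-* c f (a ∷ L) = trans (cong (c * f a +_) (sumList-* c f L)) (sym (ℚ.*-distribˡ-+ c _ _))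

  sumList-filter : ∀ {P : Pred A 0ℓ} (P? : Decidable P) (f : A → ℚ) L →
    sumList f (filter P? L) ≡ sumList (λ a → if does (P? a) then f a else 0ℚ) L
  sumList-filter P? f []      = refl
  sumList-filter P? f (a ∷ L) with does (P? a)
  ... | true  = cong (f a +_) (sumList-filter P? f L)
  ... | false = trans (sumList-filter P? f L) (sym (ℚ.+-identityˡ _))

sumList-subsets : ∀ {n} (g : Subset (suc n) → ℚ) → sumList g (subsets (suc n)) ≡
  sumList (λ K → g (outside Vec.∷ K)) (subsets n) + sumList (λ K → g (inside Vec.∷ K)) (subsets n)
sumList-subsets {n} g = trans (sumList-++ g (map (outside Vec.∷_) (subsets n)) _)
  (cong₂ _+_ (sumList-map g (outside Vec.∷_) (subsets n)) (sumList-map g (inside Vec.∷_) (subsets n)))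

-- Pairs each subset avoiding v with the one obtained by adding v.
sumList-pairing : ∀ {n} (g : Subset n → ℚ) v → sumList g (subsets n) ≡
  sumList (λ K → if lookup K v then 0ℚ else g K + g (K [ v ]≔ inside)) (subsets n)
sumList-pairing {suc n} g zero = begin
  sumList g (subsets (suc n))                    ≡⟨ sumList-subsets g ⟩
  sumList g₀ (subsets n) + sumList g₁ (subsets n)   ≡⟨ sumList-+ g₀ g₁ (subsets n) ⟨
  -- The second half of `subsets (suc n)` consists of the sets containing `zero`, which contribute 0
  -- after pairing.
  sumList (λ K → g₀ K + g₁ K) (subsets n)        ≡⟨ ℚ.+-identityʳ _ ⟨
  sumList (λ K → g₀ K + g₁ K) (subsets n) + 0ℚ
    ≡⟨ cong (sumList (λ K → g₀ K + g₁ K) (subsets n) +_)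
         (sumList-zero {f = const 0ℚ} (λ _ → refl) (subsets n)) ⟨
  sumList (λ K → g₀ K + g₁ K) (subsets n) + sumList (const 0ℚ) (subsets n)   ≡⟨ sumList-subsets h ⟨
  sumList h (subsets (suc n))                    ∎
  where
  open ≡-Reasoning
  h : Subset (suc n) → ℚ
  h K = if lookup K zero then 0ℚ else g K + g (K [ zero ]≔ inside)
  g₀ g₁ : Subset n → ℚ
  g₀ K = g (outside Vec.∷ K)
  g₁ K = g (inside Vec.∷ K)
sumList-pairing {suc n} g (suc v) = trans (sumList-subsets g)
  (trans (cong₂ _+_ (sumList-pairing (λ K → g (outside Vec.∷ K)) v) (sumList-pairing (λ K → g (inside Vec.∷ K)) v))
         (sym (sumList-subsets λ K → if lookup K (suc v) then 0ℚ else g K + g (K [ suc v ]≔ inside))))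

sumList-⊥ : ∀ {n} (g : Subset n → ℚ) → (∀ K → Nonempty K → g K ≡ 0ℚ) → sumList g (subsets n) ≡ g ⊥
sumList-⊥ {zero}  g g≡0 = ℚ.+-identityʳ _
sumList-⊥ {suc n} g g≡0 = trans (sumList-subsets g) (trans
  (cong₂ _+_ (sumList-⊥ _ λ { K (v , v∈K) → g≡0 _ (suc v , Vec.there v∈K) })
             (sumList-zero (λ K → g≡0 _ (zero , Vec.here)) (subsets n)))
  (ℚ.+-identityʳ _))

-- The clique polynomial at rational points

IsCliqueIn : Graph n → Subset n → Subset n → Set
IsCliqueIn G S K = K ⊆ S × IsClique G K

isCliqueIn? : ∀ (G : Graph n) S K → Dec (IsCliqueIn G S K)
isCliqueIn? G S K = (K ⊆? S) ×-dec isClique? G K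

-- Other subsets get the value 0 instead of being filtered out, so that every sum runs over the same
-- list `subsets n` and sums for different `S` can be compared term by term.
term : Graph n → Subset n → ℚ → Subset n → ℚ
term G S y K = if does (isCliqueIn? G S K) then y ^ℚ ∣ K ∣ else 0ℚ

cliqueSum : Graph n → Subset n → ℚ → ℚ
cliqueSum G S y = sumList (term G S y) (subsets _)

cliqueSum-⊥ : ∀ (G : Graph n) y → cliqueSum G ⊥ y ≡ 1ℚ
cliqueSum-⊥ {n} G y = trans (sumList-⊥ (term G ⊥ y) vanish) at⊥
  where
  vanish : ∀ K → Nonempty K → term G ⊥ y K ≡ 0ℚ
  vanish K (v , v∈K) rewrite dec-false (isCliqueIn? G ⊥ K) (λ (K⊆⊥ , _) → ∉⊥ (K⊆⊥ v∈K)) = refl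
  at⊥ : term G ⊥ y ⊥ ≡ 1ℚ
  at⊥ rewrite dec-true (isCliqueIn? G ⊥ ⊥) (⊆-refl , λ u v u∈⊥ → ⊥-elim (∉⊥ u∈⊥)) = cong (y ^ℚ_) (∣⊥∣≡0 n)

-- The deletion recurrence

module _ (G : Graph n) where

  private
    adjoin⁻ : ∀ {K : Subset n} {v x} → x ∈ K [ v ]≔ inside → x ≢ v → x ∈ K
    adjoin⁻ {K} {v} {x} x∈ x≢v = Vec.lookup⇒[]= x K
      (trans (sym (Vec.lookup∘updateAt′ x v x≢v K)) (Vec.[]=⇒lookup x∈))

    adjoin⁺ : ∀ {K : Subset n} {v x} → x ∈ K → x ∈ K [ v ]≔ inside
    adjoin⁺ {K} {v} {x} x∈K with x Fin.≟ v
    ... | yes refl = Vec.[]≔-updates K v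
    ... | no  x≢v  = Vec.[]≔-minimal K x v x≢v x∈K

    without : ∀ {S K v} → v ∉ K → IsCliqueIn G S K ⇔ IsCliqueIn G (S - v) K
    without {S} v∉K = mk⇔ (λ (K⊆S , cl) → p⊆q∧x∉p⇒p⊆q-x K⊆S v∉K , cl)
                          (λ (K⊆  , cl) → p-x⊆p S _ ∘ K⊆ , cl)

    adjoined : ∀ {S K v} → v ∈ S → v ∉ K →
      IsCliqueIn G S (K [ v ]≔ inside) ⇔ IsCliqueIn G (S ∩ neighbours G v) K
    adjoined {S} {K} {v} v∈S v∉K = mk⇔ to from
      where
      to : IsCliqueIn G S (K [ v ]≔ inside) → IsCliqueIn G (S ∩ neighbours G v) K
      to (⊆S , cl) =
        (λ {x} x∈K → x∈p∩q⁺ (⊆S (adjoin⁺ x∈K) , ∈-fromDec⁺ (edge? G v)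
          (cl v x (Vec.[]≔-updates K v) (adjoin⁺ x∈K) λ { refl → v∉K x∈K }))) ,
        λ u w u∈K w∈K → cl u w (adjoin⁺ u∈K) (adjoin⁺ w∈K)
      from : IsCliqueIn G (S ∩ neighbours G v) K → IsCliqueIn G S (K [ v ]≔ inside)
      from (K⊆ , cl) = ⊆S , clique
        where
        edge : ∀ {x} → x ∈ K → Edge G v x
        edge x∈K = ∈-fromDec⁻ (edge? G v) (proj₂ (x∈p∩q⁻ S _ (K⊆ x∈K)))
        ⊆S : K [ v ]≔ inside ⊆ S
        ⊆S {x} x∈ with x Fin.≟ v
        ... | yes refl = v∈S
        ... | no  x≢v  = proj₁ (x∈p∩q⁻ S _ (K⊆ (adjoin⁻ x∈ x≢v)))
        clique : IsClique G (K [ v ]≔ inside)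
        clique u w u∈ w∈ u≢w with u Fin.≟ v | w Fin.≟ v
        ... | yes refl | yes refl = contradiction refl u≢w
        ... | yes refl | no  w≢v  = edge (adjoin⁻ w∈ w≢v)
        ... | no  u≢v  | yes refl = symm G (edge (adjoin⁻ u∈ u≢v))
        ... | no  u≢v  | no  w≢v  = cl u w (adjoin⁻ u∈ u≢v) (adjoin⁻ w∈ w≢v) u≢w

  -- Cliques avoiding `v` are the cliques in `S - v`. Removing `v` from a clique that contains it
  -- leaves a clique among the neighbours of `v` and costs one factor `y`.
  cliqueSum-step : ∀ {S v} y → v ∈ S →
    cliqueSum G S y ≡ cliqueSum G (S - v) y + y * cliqueSum G (S ∩ neighbours G v) y
  cliqueSum-step {S} {v} y v∈S = begin
    cliqueSum G S y
      ≡⟨ sumList-pairing (term G S y) v ⟩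
    sumList (λ K → if lookup K v then 0ℚ else term G S y K + term G S y (K [ v ]≔ inside)) (subsets n)
      ≡⟨ sumList-cong (λ K → pointwise K (lookup K v) refl) (subsets n) ⟩
    sumList (λ K → term G (S - v) y K + y * term G (S ∩ neighbours G v) y K) (subsets n)
      ≡⟨ sumList-+ (term G (S - v) y) _ (subsets n) ⟩
    cliqueSum G (S - v) y + sumList (λ K → y * term G (S ∩ neighbours G v) y K) (subsets n)
      ≡⟨ cong (cliqueSum G (S - v) y +_) (sumList-* y (term G (S ∩ neighbours G v) y) (subsets n)) ⟩
    cliqueSum G (S - v) y + y * cliqueSum G (S ∩ neighbours G v) y
      ∎
    where
    open ≡-Reasoning
    ∉-lookup : ∀ {K : Subset n} → lookup K v ≡ outside → v ∉ K
    ∉-lookup eq v∈K with () ← trans (sym eq) (Vec.[]=⇒lookup v∈K)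
    pointwise : ∀ K b → lookup K v ≡ b →
      (if b then 0ℚ else term G S y K + term G S y (K [ v ]≔ inside)) ≡
      term G (S - v) y K + y * term G (S ∩ neighbours G v) y K
    -- When `v ∈ K`, both terms on the right vanish: `v` is neither in `S - v` nor adjacent to
    -- itself.
    pointwise K true eq
      rewrite dec-false (isCliqueIn? G (S - v) K)
                (λ (K⊆ , _) → proj₂ (x∈p-y⁻ S v (K⊆ (Vec.lookup⇒[]= v K eq))) refl)
            | dec-false (isCliqueIn? G (S ∩ neighbours G v) K)
                (λ (K⊆ , _) → irrefl G refl (∈-fromDec⁻ (edge? G v) (proj₂ (x∈p∩q⁻ S _ (K⊆ (Vec.lookup⇒[]= v K eq))))))
      = sym (trans (ℚ.+-identityˡ _) (ℚ.*-zeroʳ y))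
    pointwise K false eq
      rewrite does-⇔ (without {S} (∉-lookup eq)) (isCliqueIn? G S K) (isCliqueIn? G (S - v) K)
            | does-⇔ (adjoined v∈S (∉-lookup eq)) (isCliqueIn? G S (K [ v ]≔ inside))
                (isCliqueIn? G (S ∩ neighbours G v) K)
            | ∣p[x]≔inside∣ K v eq
      = cong (term G (S - v) y K +_) (if-* (does (isCliqueIn? G (S ∩ neighbours G v) K)))
      where
      if-* : ∀ b → (if b then y * y ^ℚ ∣ K ∣ else 0ℚ) ≡ y * (if b then y ^ℚ ∣ K ∣ else 0ℚ)
      if-* true  = refl
      if-* false = sym (ℚ.*-zeroʳ y)

-- Comparison of clique polynomials

*-monoˡ-≤ : ∀ {a b} c → 0ℚ ≤ c → a ≤ b → c * a ≤ c * b
*-monoˡ-≤ c 0≤c = ℚ.*-monoˡ-≤-nonNeg c {{ℚ.nonNegative 0≤c}}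

*-monoʳ-≤ : ∀ {a b} c → 0ℚ ≤ c → a ≤ b → a * c ≤ b * c
*-monoʳ-≤ c 0≤c = ℚ.*-monoʳ-≤-nonNeg c {{ℚ.nonNegative 0≤c}}

*-antimonoˡ-≤ : ∀ {a b} c → c ≤ 0ℚ → a ≤ b → c * b ≤ c * a
*-antimonoˡ-≤ c c≤0 = ℚ.*-monoˡ-≤-nonPos c {{ℚ.nonPositive c≤0}}

0<* : ∀ {a b} → 0ℚ < a → 0ℚ < b → 0ℚ < a * b
0<* {a} {b} 0<a 0<b = ℚ.positive⁻¹ (a * b) {{ℚ.pos*pos⇒pos a {{ℚ.positive 0<a}} b {{ℚ.positive 0<b}}}}

-- Multiplies a / b ≤ a′ / b′ by b / c ≤ b′ / c′, both in cross-multiplied form; `b` is cancelled at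
-- the end, hence its strict positivity.
cross-trans : ∀ {a a′ b b′ c c′} → 0ℚ ≤ a → 0ℚ < b → 0ℚ ≤ c →
  a * b′ ≤ a′ * b → b * c′ ≤ b′ * c → a * c′ ≤ a′ * c
cross-trans {a} {a′} {b} {b′} {c} {c′} 0≤a 0<b 0≤c ab′≤a′b bc′≤b′c =
  ℚ.*-cancelˡ-≤-pos b {{ℚ.positive 0<b}} (begin
    b * (a * c′)    ≡⟨ solve 3 (λ a b c → b :* (a :* c) := a :* (b :* c)) refl a b c′ ⟩
    a * (b * c′)    ≤⟨ *-monoˡ-≤ a 0≤a bc′≤b′c ⟩
    a * (b′ * c)    ≡⟨ ℚ.*-assoc a b′ c ⟨
    a * b′ * c      ≤⟨ *-monoʳ-≤ c 0≤c ab′≤a′b ⟩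
    a′ * b * c      ≡⟨ solve 3 (λ a b c → a :* b :* c := b :* (a :* c)) refl a′ b c ⟩
    b * (a′ * c)    ∎)
  where
  open ℚ.≤-Reasoning
  open +-*-Solver

-- Abstracts S ↦ cliqueSum G S y, with N v the neighbourhood of v.
Recurrence : (Subset n → ℚ) → (Fin n → Subset n) → ℚ → Set
Recurrence P N y = ∀ S v → v ∈ S → P S ≡ P (S - v) + y * P (S ∩ N v)

PositiveWithin : Subset n → (Subset n → ℚ) → Set
PositiveWithin B P = ∀ S → S ⊆ B → 0ℚ < P S

-- Deleting a vertex drops the summand `y * P (S ∩ N v)`, which is nonpositive since `y ≤ 0` and `P`
-- is positive within `B`.
antitone : ∀ {B : Subset n} {P N y} → Recurrence P N y → y ≤ 0ℚ → PositiveWithin B P →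
  ∀ S → S ⊆ B → ∀ T → T ⊆ S → P S ≤ P T
antitone {B = B} {P} {N} {y} rec y≤0 pos =
  removal-induction (λ S → S ⊆ B → ∀ T → T ⊆ S → P S ≤ P T) step
  where
  open ℚ.≤-Reasoning
  step : ∀ S → (∀ {v} → v ∈ S → S - v ⊆ B → ∀ T → T ⊆ S - v → P (S - v) ≤ P T) →
    S ⊆ B → ∀ T → T ⊆ S → P S ≤ P T
  step S ih S⊆B T T⊆S with ∖-nonempty? S T
  ... | no  ∄ = ℚ.≤-reflexive (cong P (sym (⊆∧∄∈∖⇒≡ T⊆S ∄)))
  ... | yes (v , v∈S , v∉T) = begin
    P S                              ≡⟨ rec S v v∈S ⟩
    P (S - v) + y * P (S ∩ N v)
      ≤⟨ ℚ.+-monoʳ-≤ (P (S - v))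
           (*-antimonoˡ-≤ y y≤0 (ℚ.<⇒≤ (pos (S ∩ N v) λ x∈ → S⊆B (p∩q⊆p S (N v) x∈)))) ⟩
    P (S - v) + y * 0ℚ               ≡⟨ cong (P (S - v) +_) (ℚ.*-zeroʳ y) ⟩
    P (S - v) + 0ℚ                   ≡⟨ ℚ.+-identityʳ _ ⟩
    P (S - v)                        ≤⟨ ih v∈S (λ x∈ → S⊆B (p-x⊆p S v x∈)) T (p⊆q∧x∉p⇒p⊆q-x T⊆S v∉T) ⟩
    P T                              ∎

-- Adding edges and moving y towards 0 increases every ratio P S / P T with T ⊆ S.
module Comparison {B : Subset n} {P P′ : Subset n → ℚ} {N N′ : Fin n → Subset n} {y y′ : ℚ}
  (rec : Recurrence P N y) (rec′ : Recurrence P′ N′ y′)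
  (N⊆N′ : ∀ v → N v ⊆ N′ v) (irrefl′ : ∀ v → v ∉ N′ v)
  (y≤y′ : y ≤ y′) (y′≤0 : y′ ≤ 0ℚ)
  (P⊥ : P ⊥ ≡ 1ℚ) (P′⊥ : P′ ⊥ ≡ 1ℚ) (pos : PositiveWithin B P) where

  private
    -- Both halves go into one induction: the ratio bound at `S` uses `0 < P′ (S - v)`, and
    -- positivity at `S` follows from the ratio bound between `S` and `S - v`.
    Claim : Subset n → Set
    Claim S = S ⊆ B → 0ℚ < P′ S × (∀ T → T ⊆ S → P S * P′ T ≤ P′ S * P T)

    antitoneP : ∀ S → S ⊆ B → ∀ T → T ⊆ S → P S ≤ P T
    antitoneP = antitone {N = N} rec (ℚ.≤-trans y≤y′ y′≤0) pos

    module Step (S : Subset n) (ih : ∀ {v} → v ∈ S → Claim (S - v)) (S⊆B : S ⊆ B) where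
      open ℚ.≤-Reasoning

      S-v⊆B : ∀ v → S - v ⊆ B
      S-v⊆B v x∈ = S⊆B (p-x⊆p S v x∈)

      -- With the abbreviations below, P S / a = 1 + y b / a and P′ S / a′ = 1 + y′ c′ / a′. Since
      -- `N v ⊆ N′ v`, `antitone` gives c ≤ b, so y b ≤ y c ≤ y′ c. The set `S ∩ N′ v` omits `v`, so
      -- the induction hypothesis gives c′ / a′ ≤ c / a, which the factor y′ ≤ 0 reverses.
      cross-remove : ∀ {v} → v ∈ S → P S * P′ (S - v) ≤ P′ S * P (S - v)
      cross-remove {v} v∈S = begin
        P S * a′                      ≡⟨ cong (_* a′) (rec S v v∈S) ⟩
        (a + y * b) * a′
          ≡⟨ solve 4 (λ a a′ b y → (a :+ y :* b) :* a′ := a :* a′ :+ a′ :* (y :* b)) refl a a′ b y ⟩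
        a * a′ + a′ * (y * b)         ≤⟨ ℚ.+-monoʳ-≤ (a * a′) (*-monoˡ-≤ a′ (ℚ.<⇒≤ 0<a′) yb≤y′c) ⟩
        a * a′ + a′ * (y′ * c)
          ≡⟨ cong (a * a′ +_) (solve 3 (λ a c y → a :* (y :* c) := y :* (a :* c)) refl a′ c y′) ⟩
        a * a′ + y′ * (a′ * c)        ≤⟨ ℚ.+-monoʳ-≤ (a * a′) (*-antimonoˡ-≤ y′ y′≤0 ac′≤a′c) ⟩
        a * a′ + y′ * (a * c′)
          ≡⟨ solve 4 (λ a a′ c y → a :* a′ :+ y :* (a :* c) := (a′ :+ y :* c) :* a) refl a a′ c′ y′ ⟩
        (a′ + y′ * c′) * a            ≡⟨ cong (_* a) (rec′ S v v∈S) ⟨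
        P′ S * a                      ∎
        where
        open +-*-Solver
        a a′ b c c′ : ℚ
        a  = P (S - v)
        a′ = P′ (S - v)
        b  = P (S ∩ N v)
        c  = P (S ∩ N′ v)
        c′ = P′ (S ∩ N′ v)
        0<a′ : 0ℚ < a′
        0<a′ = proj₁ (ih v∈S (S-v⊆B v))
        N′⊆ : S ∩ N′ v ⊆ S - v
        N′⊆ x∈ = let x∈S , x∈N′ = x∈p∩q⁻ S (N′ v) x∈ in
          x∈p∧x≢y⇒x∈p-y x∈S λ { refl → irrefl′ v x∈N′ }
        ac′≤a′c : a * c′ ≤ a′ * c
        ac′≤a′c = proj₂ (ih v∈S (S-v⊆B v)) _ N′⊆
        S∩N⊆S∩N′ : S ∩ N v ⊆ S ∩ N′ v
        S∩N⊆S∩N′ x∈ = let x∈S , x∈N = x∈p∩q⁻ S (N v) x∈ in x∈p∩q⁺ (x∈S , N⊆N′ v x∈N)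
        S∩N′⊆B : S ∩ N′ v ⊆ B
        S∩N′⊆B x∈ = S⊆B (p∩q⊆p S (N′ v) x∈)
        yb≤y′c : y * b ≤ y′ * c
        yb≤y′c = ℚ.≤-trans
          (*-antimonoˡ-≤ y (ℚ.≤-trans y≤y′ y′≤0) (antitoneP _ S∩N′⊆B _ S∩N⊆S∩N′))
          (*-monoʳ-≤ c (ℚ.<⇒≤ (pos _ S∩N′⊆B)) y≤y′)

      positive : 0ℚ < P′ S
      positive with nonempty? S
      ... | no empty = subst (0ℚ <_) (sym (trans (cong P′ (Empty-unique empty)) P′⊥)) (ℚ.positive⁻¹ 1ℚ)
      ... | yes (v , v∈S) = ℚ.*-cancelʳ-<-nonNeg (P (S - v)) {{ℚ.nonNegative (ℚ.<⇒≤ (pos _ (S-v⊆B v)))}}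
        (begin-strict
          0ℚ * P (S - v)      ≡⟨ ℚ.*-zeroˡ (P (S - v)) ⟩
          0ℚ                  <⟨ 0<* (pos S S⊆B) (proj₁ (ih v∈S (S-v⊆B v))) ⟩
          P S * P′ (S - v)    ≤⟨ cross-remove v∈S ⟩
          P′ S * P (S - v)    ∎)

      cross : ∀ T → T ⊆ S → P S * P′ T ≤ P′ S * P T
      cross T T⊆S with ∖-nonempty? S T
      ... | no  ∄ rewrite ⊆∧∄∈∖⇒≡ T⊆S ∄ = ℚ.≤-reflexive (ℚ.*-comm (P S) (P′ S))
      -- The ratio P S / P T factors through `S - v`: the first factor is handled by `cross-remove`,
      -- the second by induction.
      ... | yes (v , v∈S , v∉T) =
        cross-trans {P S} {P′ S} {P (S - v)} {P′ (S - v)} {P T} {P′ T}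
          (ℚ.<⇒≤ (pos S S⊆B)) (pos _ (S-v⊆B v)) (ℚ.<⇒≤ (pos T λ x∈ → S⊆B (T⊆S x∈)))
          (cross-remove v∈S) (proj₂ (ih v∈S (S-v⊆B v)) T (p⊆q∧x∉p⇒p⊆q-x T⊆S v∉T))

    claim : ∀ S → Claim S
    claim = removal-induction Claim λ S ih S⊆B → Step.positive S ih S⊆B , Step.cross S ih S⊆B

  positive′ : PositiveWithin B P′
  positive′ S S⊆B = proj₁ (claim S S⊆B)

  -- The ratio comparison at `T = ⊥`, where both denominators are 1.
  P≤P′ : ∀ S → S ⊆ B → P S ≤ P′ S
  P≤P′ S S⊆B = begin
    P S           ≡⟨ ℚ.*-identityʳ (P S) ⟨
    P S * 1ℚ      ≡⟨ cong (P S *_) P′⊥ ⟨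
    P S * P′ ⊥    ≤⟨ proj₂ (claim S S⊆B) ⊥ (⊆-min S) ⟩
    P′ S * P ⊥    ≡⟨ cong (P′ S *_) P⊥ ⟩
    P′ S * 1ℚ     ≡⟨ ℚ.*-identityʳ (P′ S) ⟩
    P′ S          ∎
    where open ℚ.≤-Reasoning

-- The archimedean property of ℚ

×-monoʳ-≤ : ∀ k {a b} → a ≤ b → k ×ℚ a ≤ k ×ℚ b
×-monoʳ-≤ zero    a≤b = ℚ.≤-refl
×-monoʳ-≤ (suc k) a≤b = ℚ.+-mono-≤ a≤b (×-monoʳ-≤ k a≤b)

×-nonneg : ∀ k {a} → 0ℚ ≤ a → 0ℚ ≤ k ×ℚ a
×-nonneg zero    0≤a = ℚ.≤-refl
×-nonneg (suc k) 0≤a = ℚ.+-mono-≤ 0≤a (×-nonneg k 0≤a)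

×-monoˡ-≤ : ∀ {k l a} → 0ℚ ≤ a → k ℕ.≤ l → k ×ℚ a ≤ l ×ℚ a
×-monoˡ-≤ {l = l} 0≤a z≤n       = ×-nonneg l 0≤a
×-monoˡ-≤ {a = a} 0≤a (s≤s k≤l) = ℚ.+-monoʳ-≤ a (×-monoˡ-≤ 0≤a k≤l)

×-*-comm : ∀ k c a → k ×ℚ (c * a) ≡ c * (k ×ℚ a)
×-*-comm zero    c a = sym (ℚ.*-zeroʳ c)
×-*-comm (suc k) c a = trans (cong (c * a +_) (×-*-comm k c a)) (sym (ℚ.*-distribˡ-+ c a (k ×ℚ a)))

fromℕ : ℕ → ℚ
fromℕ k = ℚ.mkℚ (ℤ.+ k) 0 (ℕ.sym (ℕ.1-coprimeTo k))

×1≡fromℕ : ∀ k → k ×ℚ 1ℚ ≡ fromℕ k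
×1≡fromℕ zero    = refl
×1≡fromℕ (suc k) = trans (cong (1ℚ +_) (×1≡fromℕ k)) (ℚ.toℚᵘ-injective
  (ℚᵘ.≃-trans (ℚ.toℚᵘ-homo-+ 1ℚ (fromℕ k)) (ℚᵘ.*≡* (cong (λ i → (ℤ.1ℤ ℤ.+ i) ℤ.* ℤ.1ℤ) (ℤ.*-identityʳ (ℤ.+ k))))))

archimedean : ∀ {ε} → 0ℚ < ε → ∃ λ k → 1ℚ < k ×ℚ ε
archimedean {ℚ.mkℚ (ℤ.+ zero)  d c} 0<ε = contradiction (ℚ.positive 0<ε) λ where record { pos = () }
archimedean {ℚ.mkℚ (ℤ.-[1+ _ ]) d c} 0<ε = contradiction (ℚ.positive 0<ε) λ where record { pos = () }
-- The denominator of `ε` is `suc d`, so `suc d` copies already reach 1; one more copy makes the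
-- inequality strict.
archimedean {ε@(ℚ.mkℚ (ℤ.+ suc p) d c)} 0<ε = suc (suc d) , (begin-strict
    1ℚ                    ≡⟨ ℚ.+-identityˡ 1ℚ ⟨
    0ℚ + 1ℚ               <⟨ ℚ.+-monoˡ-< 1ℚ 0<ε ⟩
    ε + 1ℚ                ≤⟨ ℚ.+-monoʳ-≤ ε 1≤ ⟩
    ε + suc d ×ℚ ε        ∎)
  where
  open ℚ.≤-Reasoning
  1≤ : 1ℚ ≤ suc d ×ℚ ε
  1≤ = begin
    1ℚ                     ≤⟨ ℚ.toℚᵘ-cancel-≤
      (ℚᵘ.≤-respʳ-≃ (ℚᵘ.≃-sym (ℚ.toℚᵘ-homo-* ε (fromℕ (suc d)))) (ℚᵘ.*≤* (ℤ.+≤+ le))) ⟩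
    ε * fromℕ (suc d)      ≡⟨ cong (ε *_) (×1≡fromℕ (suc d)) ⟨
    ε * (suc d ×ℚ 1ℚ)      ≡⟨ ×-*-comm (suc d) ε 1ℚ ⟨
    suc d ×ℚ (ε * 1ℚ)      ≡⟨ cong (suc d ×ℚ_) (ℚ.*-identityʳ ε) ⟩
    suc d ×ℚ ε             ∎
    where
    le : 1 ℕ.* (suc d ℕ.* 1) ℕ.≤ (suc p ℕ.* suc d) ℕ.* 1
    le = ℕ.≤-trans (ℕ.≤-reflexive (ℕ.*-identityˡ _)) (ℕ.*-monoˡ-≤ 1 (ℕ.m≤n*m (suc d) (suc p)))

0<½^ : ∀ k → 0ℚ < ½ ^ℚ k
0<½^ zero    = ℚ.positive⁻¹ 1ℚ
0<½^ (suc k) = 0<* (ℚ.positive⁻¹ ½) (0<½^ k)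

-- This is 1 + k ≤ 2^k. In the induction, 2 + k ≤ 2 (1 + k) and the doubled count absorbs the new
-- factor ½.
[1+k]×½^k≤1 : ∀ k → suc k ×ℚ ½ ^ℚ k ≤ 1ℚ
[1+k]×½^k≤1 zero    = ℚ.≤-refl
[1+k]×½^k≤1 (suc k) = begin
  suc (suc k) ×ℚ (½ * h)             ≤⟨ ×-monoˡ-≤ (ℚ.<⇒≤ (0<½^ (suc k))) 2+k≤ ⟩
  (suc k ℕ.+ suc k) ×ℚ (½ * h)       ≡⟨ ×-homo-+ (½ * h) (suc k) (suc k) ⟩
  suc k ×ℚ (½ * h) + suc k ×ℚ (½ * h) ≡⟨ cong₂ _+_ (×-*-comm (suc k) ½ h) (×-*-comm (suc k) ½ h) ⟩
  ½ * (suc k ×ℚ h) + ½ * (suc k ×ℚ h) ≡⟨ CauchyProperties.half+half _ ⟩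
  suc k ×ℚ h                         ≤⟨ [1+k]×½^k≤1 k ⟩
  1ℚ                                 ∎
  where
  open ℚ.≤-Reasoning
  h = ½ ^ℚ k
  2+k≤ : suc (suc k) ℕ.≤ suc k ℕ.+ suc k
  2+k≤ = s≤s (ℕ.m≤n+m (suc k) k)

k×½^k<1 : ∀ k → k ×ℚ ½ ^ℚ k < 1ℚ
k×½^k<1 k = ℚ.<-≤-trans
  (subst (_< suc k ×ℚ ½ ^ℚ k) (ℚ.+-identityˡ _)
  (ℚ.+-monoˡ-< (k ×ℚ ½ ^ℚ k) (0<½^ k))) ([1+k]×½^k≤1 k)

-- Choose `l` with 1 < l ε. For k ≥ l M, the inequality ε ≤ M / 2^k would give 1 < l M / 2^k ≤ k /
-- 2^k, against `k×½^k<1`.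
½^-vanishes : ∀ M {ε} → 0ℚ < ε → ∃ λ N → ∀ k → N ℕ.≤ k → M ×ℚ ½ ^ℚ k < ε
½^-vanishes M {ε} 0<ε with archimedean 0<ε
... | l , 1<lε = l ℕ.* M , λ k lM≤k → ℚ.≰⇒> λ ε≤ → ℚ.<-irrefl refl (begin-strict
    1ℚ                       <⟨ 1<lε ⟩
    l ×ℚ ε                   ≤⟨ ×-monoʳ-≤ l ε≤ ⟩
    l ×ℚ (M ×ℚ ½ ^ℚ k)       ≡⟨ ×-assocˡ (½ ^ℚ k) l M ⟩
    (l ℕ.* M) ×ℚ ½ ^ℚ k      ≤⟨ ×-monoˡ-≤ (ℚ.<⇒≤ (0<½^ k)) lM≤k ⟩
    k ×ℚ ½ ^ℚ k              <⟨ k×½^k<1 k ⟩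
    1ℚ                       ∎)
  where open ℚ.≤-Reasoning

-- A Lipschitz bound uniform in S

∣y^k∣≤1 : ∀ k {y} → ℚ.∣ y ∣ ≤ 1ℚ → ℚ.∣ y ^ℚ k ∣ ≤ 1ℚ
∣y^k∣≤1 zero        ∣y∣≤1 = ℚ.≤-refl
∣y^k∣≤1 (suc k) {y} ∣y∣≤1 = begin
  ℚ.∣ y * y ^ℚ k ∣             ≡⟨ ℚ.∣p*q∣≡∣p∣*∣q∣ y (y ^ℚ k) ⟩
  ℚ.∣ y ∣ * ℚ.∣ y ^ℚ k ∣       ≤⟨ *-monoˡ-≤ ℚ.∣ y ∣ (ℚ.0≤∣p∣ y) (∣y^k∣≤1 k ∣y∣≤1) ⟩
  ℚ.∣ y ∣ * 1ℚ                 ≡⟨ ℚ.*-identityʳ _ ⟩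
  ℚ.∣ y ∣                      ≤⟨ ∣y∣≤1 ⟩
  1ℚ                           ∎
  where open ℚ.≤-Reasoning

∣*∣≤ : ∀ {a} b → ℚ.∣ a ∣ ≤ 1ℚ → ℚ.∣ a * b ∣ ≤ ℚ.∣ b ∣
∣*∣≤ {a} b ∣a∣≤1 = begin
  ℚ.∣ a * b ∣          ≡⟨ ℚ.∣p*q∣≡∣p∣*∣q∣ a b ⟩
  ℚ.∣ a ∣ * ℚ.∣ b ∣    ≤⟨ *-monoʳ-≤ ℚ.∣ b ∣ (ℚ.0≤∣p∣ b) ∣a∣≤1 ⟩
  1ℚ * ℚ.∣ b ∣         ≡⟨ ℚ.*-identityˡ _ ⟩
  ℚ.∣ b ∣              ∎
  where open ℚ.≤-Reasoning

module Lipschitz {y z : ℚ} (∣y∣≤1 : ℚ.∣ y ∣ ≤ 1ℚ) (∣z∣≤1 : ℚ.∣ z ∣ ≤ 1ℚ) where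
  open ℚ.≤-Reasoning
  open +-*-Solver

  δ : ℚ
  δ = ℚ.∣ y -ℚ z ∣

  -- One step telescopes the difference as y^k (y - z) + z (y^k - z^k), with the coefficients y^k
  -- and z bounded by 1.
  ^-lipschitz : ∀ k → ℚ.∣ y ^ℚ k -ℚ z ^ℚ k ∣ ≤ k ×ℚ δ
  ^-lipschitz zero    = ℚ.≤-refl
  ^-lipschitz (suc k) = begin
    ℚ.∣ y * y ^ℚ k -ℚ z * z ^ℚ k ∣
      ≡⟨ cong ℚ.∣_∣ (solve 4 (λ y z a b → y :* a :- z :* b := a :* (y :- z) :+ z :* (a :- b)) refl y z (y ^ℚ k) (z ^ℚ k)) ⟩
    ℚ.∣ y ^ℚ k * (y -ℚ z) + z * (y ^ℚ k -ℚ z ^ℚ k) ∣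
      ≤⟨ ℚ.∣p+q∣≤∣p∣+∣q∣ (y ^ℚ k * (y -ℚ z)) (z * (y ^ℚ k -ℚ z ^ℚ k)) ⟩
    ℚ.∣ y ^ℚ k * (y -ℚ z) ∣ + ℚ.∣ z * (y ^ℚ k -ℚ z ^ℚ k) ∣
      ≤⟨ ℚ.+-mono-≤ (∣*∣≤ (y -ℚ z) (∣y^k∣≤1 k ∣y∣≤1))
           (ℚ.≤-trans (∣*∣≤ (y ^ℚ k -ℚ z ^ℚ k) ∣z∣≤1) (^-lipschitz k)) ⟩
    δ + k ×ℚ δ
      ∎

  term-lipschitz : ∀ (G : Graph n) S K → ℚ.∣ term G S y K -ℚ term G S z K ∣ ≤ ∣ K ∣ ×ℚ δ
  term-lipschitz G S K with does (isCliqueIn? G S K)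
  ... | true  = ^-lipschitz ∣ K ∣
  ... | false = ×-nonneg ∣ K ∣ (ℚ.0≤∣p∣ (y -ℚ z))

  sumList-lipschitz : ∀ (G : Graph n) S L →
    ℚ.∣ sumList (term G S y) L -ℚ sumList (term G S z) L ∣ ≤ ListAction.sum (map ∣_∣ L) ×ℚ δ
  sumList-lipschitz G S []      = ℚ.≤-refl
  sumList-lipschitz G S (K ∷ L) = begin
    ℚ.∣ (a + b) -ℚ (c + d) ∣
      ≡⟨ cong ℚ.∣_∣ (solve 4 (λ a b c d → (a :+ b) :- (c :+ d) := (a :- c) :+ (b :- d)) refl a b c d) ⟩
    ℚ.∣ (a -ℚ c) + (b -ℚ d) ∣
      ≤⟨ ℚ.∣p+q∣≤∣p∣+∣q∣ (a -ℚ c) (b -ℚ d) ⟩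
    ℚ.∣ a -ℚ c ∣ + ℚ.∣ b -ℚ d ∣
      ≤⟨ ℚ.+-mono-≤ (term-lipschitz G S K) (sumList-lipschitz G S L) ⟩
    ∣ K ∣ ×ℚ δ + ListAction.sum (map ∣_∣ L) ×ℚ δ
      ≡⟨ ×-homo-+ δ ∣ K ∣ (ListAction.sum (map ∣_∣ L)) ⟨
    (∣ K ∣ ℕ.+ ListAction.sum (map ∣_∣ L)) ×ℚ δ
      ∎
    where
    a = term G S y K
    b = sumList (term G S y) L
    c = term G S z K
    d = sumList (term G S z) L

-- Summing the sizes of all subsets, cliques or not, makes the constant independent of `S`. The
-- bisection relies on this, because the set witnessing badness may change at each stage.
lipschitzConstant : ℕ → ℕ
lipschitzConstant n = ListAction.sum (map ∣_∣ (subsets n))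

cliqueSum-lipschitz : ∀ (G : Graph n) S {y z} → ℚ.∣ y ∣ ≤ 1ℚ → ℚ.∣ z ∣ ≤ 1ℚ →
  ℚ.∣ cliqueSum G S y -ℚ cliqueSum G S z ∣ ≤ lipschitzConstant n ×ℚ ℚ.∣ y -ℚ z ∣
cliqueSum-lipschitz G S ∣y∣≤1 ∣z∣≤1 = Lipschitz.sumList-lipschitz ∣y∣≤1 ∣z∣≤1 G S (subsets _)

-- The real clique polynomial, termwise

seq-× : ∀ k x j → seq (k ×ᴿ x) j ≡ k ×ℚ seq x j
seq-× zero    x j = refl
seq-× (suc k) x j = cong (seq x j +_) (seq-× k x j)

seq-^ : ∀ k x j → seq (x ^ᴿ k) j ≡ seq x j ^ℚ k
seq-^ zero    x j = refl
seq-^ (suc k) x j = cong (seq x j *_) (seq-^ k x j)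

seq-sum : ∀ {k} (f : Fin k → ℝ) j → seq (sumᴿ f) j ≡ sumℚ (λ i → seq (f i) j)
seq-sum {zero}  f j = refl
seq-sum {suc k} f j = cong (seq (f zero) j +_) (seq-sum (f ∘ suc) j)

sum-δ : ∀ {l} (h : ℕ → ℚ) k → k ℕ.< l →
  sumℚ {l} (λ i → if does (k ℕ.≟ toℕ i) then h (toℕ i) else 0ℚ) ≡ h k
sum-δ {suc l} h zero    _         = trans (cong (h 0 +_) (∑.sum-replicate-zero l)) (ℚ.+-identityʳ (h 0))
sum-δ {suc l} h (suc k) (s≤s k<l) = trans (ℚ.+-identityˡ _) (sum-δ (h ∘ suc) k k<l)

-- Each list element adds its power of `y` at exactly one index, its size, and the bound `l` keeps
-- that index within the range of summation.
groupBySize : ∀ {A : Set} (size : A → ℕ) y {l} L → All (λ a → size a ℕ.< l) L →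
  sumℚ {l} (λ i → length (filter (λ a → size a ℕ.≟ toℕ i) L) ×ℚ y ^ℚ toℕ i) ≡
  sumList (λ a → y ^ℚ size a) L
groupBySize size y {l} []      []         = ∑.sum-replicate-zero l
groupBySize size y {l} (a ∷ L) (a<l ∷ L<l) = begin
  sumℚ {l} (λ i → count (a ∷ L) i ×ℚ y ^ℚ toℕ i)  ≡⟨ ∑.sum-cong-≗ split ⟩
  sumℚ {l} (λ i → δ i + count L i ×ℚ y ^ℚ toℕ i)  ≡⟨ ∑.∑-distrib-+ δ _ ⟩
  sumℚ δ + sumℚ {l} (λ i → count L i ×ℚ y ^ℚ toℕ i)
    ≡⟨ cong₂ _+_ (sum-δ (y ^ℚ_) (size a) a<l) (groupBySize size y L L<l) ⟩
  y ^ℚ size a + sumList (λ a → y ^ℚ size a) L        ∎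
  where
  open ≡-Reasoning
  count : List _ → Fin l → ℕ
  count L i = length (filter (λ a → size a ℕ.≟ toℕ i) L)
  δ : Fin l → ℚ
  δ i = if does (size a ℕ.≟ toℕ i) then y ^ℚ toℕ i else 0ℚ
  split : ∀ i → count (a ∷ L) i ×ℚ y ^ℚ toℕ i ≡ δ i + count L i ×ℚ y ^ℚ toℕ i
  split i with does (size a ℕ.≟ toℕ i)
  ... | true  = refl
  ... | false = sym (ℚ.+-identityˡ _)

-- Real sums and products act termwise on representing sequences, so this is an exact equality of
-- rationals; it reduces statements about real roots to estimates in ℚ.
seq-cliquePolynomial : ∀ (G : Graph n) B x j → seq (cliquePolynomial G B x) j ≡ cliqueSum G B (seq x j)
seq-cliquePolynomial {n} G B x j = begin
  seq (cliquePolynomial G B x) j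
    ≡⟨ seq-sum {suc (cliqueNumber G B)} (λ i → cliqueCount G B (toℕ i) ×ᴿ (x ^ᴿ toℕ i)) j ⟩
  sumℚ {suc (cliqueNumber G B)} (λ i → seq (cliqueCount G B (toℕ i) ×ᴿ (x ^ᴿ toℕ i)) j)
    ≡⟨ ∑.sum-cong-≗ {suc (cliqueNumber G B)} (λ i → trans (seq-× (cliqueCount G B (toℕ i)) (x ^ᴿ toℕ i) j)
         (cong (cliqueCount G B (toℕ i) ×ℚ_) (seq-^ (toℕ i) x j))) ⟩
  sumℚ {suc (cliqueNumber G B)} (λ i → cliqueCount G B (toℕ i) ×ℚ seq x j ^ℚ toℕ i)
    -- The indices run from 0 to the clique number inclusive, so every clique size is in range.
    ≡⟨ groupBySize ∣_∣ (seq x j) (cliquesIn G B)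
         (All.map s≤s (All.map⁻ (Extrema.xs≤max 0 (map ∣_∣ (cliquesIn G B))))) ⟩
  sumList (λ K → seq x j ^ℚ ∣ K ∣) (cliquesIn G B)
    ≡⟨ sumList-filter (isCliqueIn? G B) (λ K → seq x j ^ℚ ∣ K ∣) (subsets n) ⟩
  cliqueSum G B (seq x j)
    ∎
  where open ≡-Reasoning

-- Absolute values

p≤∣p∣ : ∀ p → p ≤ ℚ.∣ p ∣
p≤∣p∣ p with ℚ.≤-total 0ℚ p
... | inj₁ 0≤p = ℚ.≤-reflexive (sym (ℚ.0≤p⇒∣p∣≡p 0≤p))
... | inj₂ p≤0 = ℚ.≤-trans p≤0 (ℚ.0≤∣p∣ p)

p-q+q : ∀ p q → (p -ℚ q) + q ≡ p
p-q+q = solve 2 (λ p q → (p :- q) :+ q := p) refl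
  where open +-*-Solver

∣p-q∣<e⇒p<q+e : ∀ {p q e} → ℚ.∣ p -ℚ q ∣ < e → p < q + e
∣p-q∣<e⇒p<q+e {p} {q} {e} lt = begin-strict
  p               ≡⟨ p-q+q p q ⟨
  (p -ℚ q) + q    ≤⟨ ℚ.+-monoˡ-≤ q (p≤∣p∣ (p -ℚ q)) ⟩
  ℚ.∣ p -ℚ q ∣ + q  <⟨ ℚ.+-monoˡ-< q lt ⟩
  e + q           ≡⟨ ℚ.+-comm e q ⟩
  q + e           ∎
  where open ℚ.≤-Reasoning

-p≤r∧p≤r⇒∣p∣≤r : ∀ {p r} → p ≤ r → -ℚ p ≤ r → ℚ.∣ p ∣ ≤ r
-p≤r∧p≤r⇒∣p∣≤r {p} p≤r -p≤r with ℚ.∣p∣≡p∨∣p∣≡-p p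
... | inj₁ eq = subst (_≤ _) (sym eq) p≤r
... | inj₂ eq = subst (_≤ _) (sym eq) -p≤r

∣p-q∣≤width : ∀ {a b p q} → a ≤ p → p ≤ b → a ≤ q → q ≤ b → ℚ.∣ p -ℚ q ∣ ≤ b -ℚ a
∣p-q∣≤width {a} {b} {p} {q} a≤p p≤b a≤q q≤b = -p≤r∧p≤r⇒∣p∣≤r
  (ℚ.+-mono-≤ p≤b (ℚ.neg-antimono-≤ a≤q))
  (subst (_≤ b -ℚ a) (solve 2 (λ p q → q :- p := :- (p :- q)) refl p q)
    (ℚ.+-mono-≤ q≤b (ℚ.neg-antimono-≤ a≤p)))
  where open +-*-Solver

×-neg : ∀ k a → k ×ℚ (-ℚ a) ≡ -ℚ (k ×ℚ a)
×-neg zero    a = refl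
×-neg (suc k) a = trans (cong (-ℚ a +_) (×-neg k a)) (sym (ℚ.neg-distrib-+ a (k ×ℚ a)))

-- Bisection

module Bisection {Bad : Pred ℚ 0ℓ} (bad? : Decidable Bad) where

  record Bracket : Set where
    field
      lo hi : ℚ
      bad   : Bad lo
      good  : ¬ Bad hi
      lo≤hi : lo ≤ hi

    width : ℚ
    width = hi -ℚ lo

  open Bracket public

  module _ {a b : ℚ} (a≤b : a ≤ b) where
    open ℚ.≤-Reasoning
    a≤mid : a ≤ ½ * (a + b)
    a≤mid = begin
      a                 ≡⟨ CauchyProperties.half+half a ⟨
      ½ * a + ½ * a     ≡⟨ ℚ.*-distribˡ-+ ½ a a ⟨
      ½ * (a + a)       ≤⟨ ℚ.*-monoˡ-≤-nonNeg ½ (ℚ.+-monoʳ-≤ a a≤b) ⟩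
      ½ * (a + b)       ∎
    mid≤b : ½ * (a + b) ≤ b
    mid≤b = begin
      ½ * (a + b)       ≤⟨ ℚ.*-monoˡ-≤-nonNeg ½ (ℚ.+-monoˡ-≤ b a≤b) ⟩
      ½ * (b + b)       ≡⟨ ℚ.*-distribˡ-+ ½ b b ⟩
      ½ * b + ½ * b     ≡⟨ CauchyProperties.half+half b ⟩
      b                 ∎

  record Halving (β β′ : Bracket) : Set where
    field
      lo≤lo′ : lo β ≤ lo β′
      hi′≤hi : hi β′ ≤ hi β
      width′ : width β′ ≡ ½ * width β

  open Halving

  halve : ∀ β → Σ Bracket (Halving β)
  halve β with bad? (½ * (lo β + hi β))
  ... | yes bad-mid = record { lo = ½ * (lo β + hi β) ; hi = hi β
                             ; bad = bad-mid ; good = good β ; lo≤hi = mid≤b (lo≤hi β) }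
    , record { lo≤lo′ = a≤mid (lo≤hi β) ; hi′≤hi = ℚ.≤-refl
             ; width′ = solve 2 (λ a b → b :- con ½ :* (a :+ b) := con ½ :* (b :- a)) refl (lo β) (hi β) }
    where open +-*-Solver
  ... | no good-mid = record { lo = lo β ; hi = ½ * (lo β + hi β)
                             ; bad = bad β ; good = good-mid ; lo≤hi = a≤mid (lo≤hi β) }
    , record { lo≤lo′ = ℚ.≤-refl ; hi′≤hi = mid≤b (lo≤hi β)
             ; width′ = solve 2 (λ a b → con ½ :* (a :+ b) :- a := con ½ :* (b :- a)) refl (lo β) (hi β) }
    where open +-*-Solver

  module Limit (β₀ : Bracket) (width₀≤1 : width β₀ ≤ 1ℚ) where

    bracket : ℕ → Bracket
    bracket zero    = β₀
    bracket (suc k) = proj₁ (halve (bracket k))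

    width≤ : ∀ k → width (bracket k) ≤ ½ ^ℚ k
    width≤ zero    = width₀≤1
    width≤ (suc k) = subst (_≤ ½ ^ℚ suc k) (sym (width′ (proj₂ (halve (bracket k)))))
      (ℚ.*-monoˡ-≤-nonNeg ½ (width≤ k))

    -- The order `≤′` permits induction on the later index, following the recursion of `bracket`.
    nested : ∀ {j k} → j ℕ.≤′ k → lo (bracket j) ≤ lo (bracket k) × hi (bracket k) ≤ hi (bracket j)
    nested ℕ.≤′-refl = ℚ.≤-refl , ℚ.≤-refl
    nested {k = suc k} (ℕ.≤′-step j≤k) = let l , h = nested j≤k ; d = proj₂ (halve (bracket k)) in
      ℚ.≤-trans l (lo≤lo′ d) , ℚ.≤-trans (hi′≤hi d) h

    -- The upper ends are taken as representatives, so that no term of the sequence is bad.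
    limit : ℝ
    limit = mkℝ (λ k → hi (bracket k)) λ ε 0<ε → let N , small = ½^-vanishes 1 0<ε in
      N , λ i j N≤i N≤j → begin-strict
        ℚ.∣ hi (bracket i) -ℚ hi (bracket j) ∣
          ≤⟨ ∣p-q∣≤width (lo≤ N≤i) (≤hi N≤i) (lo≤ N≤j) (≤hi N≤j) ⟩
        width (bracket N)       ≤⟨ width≤ N ⟩
        ½ ^ℚ N                  ≡⟨ ℚ.+-identityʳ _ ⟨
        1 ×ℚ ½ ^ℚ N             <⟨ small N ℕ.≤-refl ⟩
        ε                       ∎
      where
      open ℚ.≤-Reasoning
      ≤hi : ∀ {N i} → N ℕ.≤ i → hi (bracket i) ≤ hi (bracket N)
      ≤hi N≤i = proj₂ (nested (ℕ.≤⇒≤′ N≤i))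
      lo≤ : ∀ {N i} → N ℕ.≤ i → lo (bracket N) ≤ hi (bracket i)
      lo≤ {N} {i} N≤i = ℚ.≤-trans (proj₁ (nested (ℕ.≤⇒≤′ N≤i))) (lo≤hi (bracket i))

-- Good and bad points, and a negative root by bisection

module _ (G : Graph n) (B : Subset n) where

  -- `Bad` is stated existentially: a finite search decides it, and it yields the violating set used
  -- in `cliqueSum≤`.
  Good Bad : Pred ℚ 0ℓ
  Good y = PositiveWithin B (λ S → cliqueSum G S y)
  Bad  y = ∃ λ S → S ⊆ B × cliqueSum G S y ≤ 0ℚ

  bad? : Decidable Bad
  bad? y = anySubset? λ S → (S ⊆? B) ×-dec (cliqueSum G S y ℚ.≤? 0ℚ)

  ¬bad⇒good : ∀ {y} → ¬ Bad y → Good y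
  ¬bad⇒good ¬bad S S⊆B = ℚ.≰⇒> λ ≤0 → ¬bad (S , S⊆B , ≤0)

  cliqueSum-recurrence : ∀ y → Recurrence (λ S → cliqueSum G S y) (neighbours G) y
  cliqueSum-recurrence y S v = cliqueSum-step G y

  v∉neighbours : ∀ v → v ∉ neighbours G v
  v∉neighbours v v∈ = irrefl G refl (∈-fromDec⁻ (edge? G v) v∈)

  -- The polynomial of a single vertex is 1 + y, which vanishes at -1.
  bad[-1] : Nonempty B → Bad (-ℚ 1ℚ)
  bad[-1] (v , v∈B) = ⁅ v ⁆ , ⁅v⁆⊆B , ℚ.≤-reflexive (begin
    cliqueSum G ⁅ v ⁆ (-ℚ 1ℚ)
      ≡⟨ cliqueSum-step G (-ℚ 1ℚ) (x∈⁅x⁆ v) ⟩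
    cliqueSum G (⁅ v ⁆ - v) (-ℚ 1ℚ) + (-ℚ 1ℚ) * cliqueSum G (⁅ v ⁆ ∩ neighbours G v) (-ℚ 1ℚ)
      ≡⟨ cong₂ (λ S T → cliqueSum G S (-ℚ 1ℚ) + (-ℚ 1ℚ) * cliqueSum G T (-ℚ 1ℚ))
           (Empty-unique e₁) (Empty-unique e₂) ⟩
    cliqueSum G ⊥ (-ℚ 1ℚ) + (-ℚ 1ℚ) * cliqueSum G ⊥ (-ℚ 1ℚ)
      ≡⟨ cong (λ c → c + (-ℚ 1ℚ) * c) (cliqueSum-⊥ G (-ℚ 1ℚ)) ⟩
    0ℚ ∎)
    where
    open ≡-Reasoning
    ⁅v⁆⊆B : ⁅ v ⁆ ⊆ B
    ⁅v⁆⊆B x∈ rewrite x∈⁅y⁆⇒x≡y v x∈ = v∈B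
    e₁ : ¬ Nonempty (⁅ v ⁆ - v)
    e₁ (x , x∈) = let x∈⁅v⁆ , x≢v = x∈p-y⁻ ⁅ v ⁆ v x∈ in x≢v (x∈⁅y⁆⇒x≡y v x∈⁅v⁆)
    e₂ : ¬ Nonempty (⁅ v ⁆ ∩ neighbours G v)
    e₂ (x , x∈) with x∈p∩q⁻ ⁅ v ⁆ (neighbours G v) x∈
    ... | x∈⁅v⁆ , x∈N rewrite x∈⁅y⁆⇒x≡y v x∈⁅v⁆ = v∉neighbours v x∈N

  -- Compare with the edgeless graph, whose clique polynomial is 1 + ∣ S ∣ y.
  good[-½^n] : Good (-ℚ ½ ^ℚ n)
  good[-½^n] = Comparison.positive′ {P = P} {N = λ _ → ⊥} rec
    (cliqueSum-recurrence y) (λ v x∈⊥ → contradiction x∈⊥ ∉⊥)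
    v∉neighbours ℚ.≤-refl (ℚ.neg-antimono-≤ (ℚ.<⇒≤ (0<½^ n)))
    (cong (λ k → 1ℚ + k ×ℚ y) (∣⊥∣≡0 n)) (cliqueSum-⊥ G y) pos
    where
    y : ℚ
    y = -ℚ ½ ^ℚ n
    P : Subset n → ℚ
    P S = 1ℚ + ∣ S ∣ ×ℚ y
    rec : Recurrence P (λ _ → ⊥) y
    rec S v v∈S rewrite Empty-unique {p = S ∩ ⊥} (λ (x , x∈) → ∉⊥ (p∩q⊆q S ⊥ x∈))
                  | ∣⊥∣≡0 n | ∣p∣≡1+∣p-x∣ S v∈S =
      solve 2 (λ y z → con 1ℚ :+ (y :+ z) := (con 1ℚ :+ z) :+ y :* (con 1ℚ :+ con 0ℚ)) refl y (∣ S - v ∣ ×ℚ y)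
      where open +-*-Solver
    pos : PositiveWithin B P
    pos S _ = begin-strict
      0ℚ                           ≡⟨ ℚ.+-inverseʳ (∣ S ∣ ×ℚ ½ ^ℚ n) ⟨
      ∣ S ∣ ×ℚ ½ ^ℚ n -ℚ ∣ S ∣ ×ℚ ½ ^ℚ n
        ≤⟨ ℚ.+-monoˡ-≤ (-ℚ (∣ S ∣ ×ℚ ½ ^ℚ n)) (×-monoˡ-≤ (ℚ.<⇒≤ (0<½^ n)) (∣p∣≤n S)) ⟩
      n ×ℚ ½ ^ℚ n -ℚ ∣ S ∣ ×ℚ ½ ^ℚ n
        <⟨ ℚ.+-monoˡ-< (-ℚ (∣ S ∣ ×ℚ ½ ^ℚ n)) (k×½^k<1 n) ⟩
      1ℚ -ℚ ∣ S ∣ ×ℚ ½ ^ℚ n          ≡⟨ cong (1ℚ +_) (×-neg ∣ S ∣ (½ ^ℚ n)) ⟨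
      1ℚ + ∣ S ∣ ×ℚ y               ∎
      where open ℚ.≤-Reasoning

  good⇒¬bad : ∀ {y} → Good y → ¬ Bad y
  good⇒¬bad good (S , S⊆B , ≤0) = ℚ.<-irrefl refl (ℚ.<-≤-trans (good S S⊆B) ≤0)

  module Root (B≢∅ : Nonempty B) where
    open Bisection bad?

    q₀ : ℚ
    q₀ = ½ ^ℚ n

    q₀≤1 : q₀ ≤ 1ℚ
    q₀≤1 = ℚ.≤-trans (ℚ.≤-trans (ℚ.≤-reflexive (sym (ℚ.+-identityʳ q₀)))
      (×-monoˡ-≤ {1} {suc n} (ℚ.<⇒≤ (0<½^ n)) (s≤s z≤n))) ([1+k]×½^k≤1 n)

    β₀ : Bracket
    β₀ = record { lo = -ℚ 1ℚ ; hi = -ℚ q₀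
                ; bad = bad[-1] B≢∅ ; good = good⇒¬bad good[-½^n]
                ; lo≤hi = ℚ.neg-antimono-≤ q₀≤1 }

    width₀≤1 : width β₀ ≤ 1ℚ
    width₀≤1 = ℚ.+-monoˡ-≤ 1ℚ (ℚ.neg-antimono-≤ (ℚ.<⇒≤ (0<½^ n)))

    open Limit β₀ width₀≤1

    root : ℝ
    root = limit

    good-root : ∀ k → Good (seq root k)
    good-root k = ¬bad⇒good (good (bracket k))

    -1≤lo : ∀ k → -ℚ 1ℚ ≤ lo (bracket k)
    -1≤lo k = proj₁ (nested {0} {k} (ℕ.≤⇒≤′ z≤n))

    hi≤-q₀ : ∀ k → hi (bracket k) ≤ -ℚ q₀
    hi≤-q₀ k = proj₂ (nested {0} {k} (ℕ.≤⇒≤′ z≤n))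

    hi≤0 : ∀ k → hi (bracket k) ≤ 0ℚ
    hi≤0 k = ℚ.≤-trans (hi≤-q₀ k) (ℚ.neg-antimono-≤ (ℚ.<⇒≤ (0<½^ n)))

    ∣∣≤1 : ∀ {y} → -ℚ 1ℚ ≤ y → y ≤ 0ℚ → ℚ.∣ y ∣ ≤ 1ℚ
    ∣∣≤1 -1≤y y≤0 = -p≤r∧p≤r⇒∣p∣≤r
      (ℚ.≤-trans y≤0 (ℚ.<⇒≤ (ℚ.positive⁻¹ 1ℚ))) (ℚ.neg-antimono-≤ -1≤y)

    root<0 : root <ᴿ 0ᴿ
    -- All terms are at most `-ℚ q₀`, so half of `q₀` is a uniform strict gap below 0.
    root<0 = ½ * q₀ , CauchyProperties.half-pos (0<½^ n) , 0 , λ k _ → begin-strict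
      hi (bracket k) + ½ * q₀       ≤⟨ ℚ.+-monoˡ-≤ (½ * q₀) (hi≤-q₀ k) ⟩
      -ℚ q₀ + ½ * q₀                <⟨ ℚ.+-monoʳ-< (-ℚ q₀) (ℚ.*-monoˡ-<-pos q₀ {{ℚ.positive (0<½^ n)}} ½<1) ⟩
      -ℚ q₀ + 1ℚ * q₀               ≡⟨ cong (-ℚ q₀ +_) (ℚ.*-identityˡ q₀) ⟩
      -ℚ q₀ + q₀                    ≡⟨ ℚ.+-inverseˡ q₀ ⟩
      0ℚ                            ∎
      where
      open ℚ.≤-Reasoning
      ½<1 : ½ < 1ℚ
      ½<1 = from-yes (½ ℚ.<? 1ℚ)

    -- At the upper end, the S violating positivity at the lower end satisfies 0 < P_B ≤ P_S,
    -- and P_S is small by continuity.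
    cliqueSum≤ : ∀ k → cliqueSum G B (hi (bracket k)) ≤ lipschitzConstant n ×ℚ ½ ^ℚ k
    cliqueSum≤ k = let S , S⊆B , ≤0 = bad (bracket k) in begin
      p B h
        ≤⟨ antitone {N = neighbours G} (cliqueSum-recurrence h) (hi≤0 k) (good-root k) B ⊆-refl S S⊆B ⟩
      p S h                          ≡⟨ p-q+q (p S h) (p S l) ⟨
      (p S h -ℚ p S l) + p S l       ≤⟨ ℚ.+-mono-≤ (p≤∣p∣ (p S h -ℚ p S l)) ≤0 ⟩
      ℚ.∣ p S h -ℚ p S l ∣ + 0ℚ      ≡⟨ ℚ.+-identityʳ _ ⟩
      ℚ.∣ p S h -ℚ p S l ∣
        ≤⟨ cliqueSum-lipschitz G S (∣∣≤1 (ℚ.≤-trans (-1≤lo k) l≤h) (hi≤0 k))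
                                   (∣∣≤1 (-1≤lo k) (ℚ.≤-trans l≤h (hi≤0 k))) ⟩
      lipschitzConstant n ×ℚ ℚ.∣ h -ℚ l ∣
        ≤⟨ ×-monoʳ-≤ (lipschitzConstant n)
             (ℚ.≤-trans (∣p-q∣≤width l≤h ℚ.≤-refl ℚ.≤-refl l≤h) (width≤ k)) ⟩
      lipschitzConstant n ×ℚ ½ ^ℚ k
        ∎
      where
      open ℚ.≤-Reasoning
      p : Subset n → ℚ → ℚ
      p = cliqueSum G
      h l : ℚ
      h = hi (bracket k)
      l = lo (bracket k)
      l≤h : l ≤ h
      l≤h = lo≤hi (bracket k)

    isRoot : IsNegativeRoot G B root
    isRoot = root<0 , λ ε 0<ε → let N , small = ½^-vanishes (lipschitzConstant n) 0<ε in
      N , λ k N≤k → begin-strict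
        ℚ.∣ seq (cliquePolynomial G B root) k -ℚ 0ℚ ∣
          ≡⟨ cong ℚ.∣_∣ (ℚ.+-identityʳ _) ⟩
        ℚ.∣ seq (cliquePolynomial G B root) k ∣
          ≡⟨ cong ℚ.∣_∣ (seq-cliquePolynomial G B root k) ⟩
        ℚ.∣ cliqueSum G B (seq root k) ∣
          -- Goodness of the upper end makes the value positive, so only the upper bound
          -- `cliqueSum≤` remains.
          ≡⟨ ℚ.0≤p⇒∣p∣≡p (ℚ.<⇒≤ (good-root k B ⊆-refl)) ⟩
        cliqueSum G B (seq root k)
          ≤⟨ cliqueSum≤ k ⟩
        lipschitzConstant n ×ℚ ½ ^ℚ k
          <⟨ small k N≤k ⟩
        ε ∎
      where open ℚ.≤-Reasoning

-- Transfer between the two graphs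

-- Over the empty set the polynomial is the constant 1. The vertex obtained here is what lets the
-- bisection start at -1.
negativeRoot⇒nonempty : ∀ (G : Graph n) B z → IsNegativeRoot G B z → Nonempty B
negativeRoot⇒nonempty G B z (_ , root) = decidable-stable (nonempty? B) λ empty → ℚ.<-irrefl refl (begin-strict
  1ℚ                                              ≡⟨ cong (λ q → ℚ.∣ q -ℚ 0ℚ ∣) (value empty) ⟨
  ℚ.∣ seq (cliquePolynomial G B z) N -ℚ 0ℚ ∣      <⟨ proj₂ (root 1ℚ (ℚ.positive⁻¹ 1ℚ)) N ℕ.≤-refl ⟩
  1ℚ                                              ∎)
  where
  open ℚ.≤-Reasoning
  N = proj₁ (root 1ℚ (ℚ.positive⁻¹ 1ℚ))
  value : ¬ Nonempty B → seq (cliquePolynomial G B z) N ≡ 1ℚ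
  value empty = trans (seq-cliquePolynomial G B z N)
    (trans (cong (λ S → cliqueSum G S (seq z N)) (Empty-unique empty)) (cliqueSum-⊥ G (seq z N)))

-- A section s of f pulls G back to a spanning subgraph of H.
module Section (G : Graph n) (H : Graph m) {B-G : Subset n} {B-H : Subset m} {f : Fin n → Fin m}
  (hom : IsHomomorphism G H f)
  (s : Fin m → Fin n) (fs : ∀ v → f (s v) ≡ v) (s∈ : ∀ {v} → v ∈ B-H → s v ∈ B-G) where

  -- As `f ∘ s` is the identity, these are exactly the vertices of s(S), described without searching
  -- for a preimage under `s`.
  image? : ∀ S → Decidable (λ u → f u ∈ S × s (f u) ≡ u)
  image? S u = (f u ∈? S) ×-dec (s (f u) Fin.≟ u)

  image : Subset m → Subset n
  image S = fromDec (image? S)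

  -- Neighbourhoods in the pulled-back graph; since `f` is a homomorphism, they are contained in
  -- those of `H`.
  pulled : Fin m → Subset m
  pulled v = fromDec (λ u → edge? G (s v) (s u))

  image⊆ : ∀ {S} → S ⊆ B-H → image S ⊆ B-G
  image⊆ {S} S⊆B u∈ with ∈-fromDec⁻ (image? S) u∈
  ... | fu∈S , sfu≡u = subst (_∈ B-G) sfu≡u (s∈ (S⊆B fu∈S))

  s∈image : ∀ {S v} → v ∈ S → s v ∈ image S
  s∈image {S} {v} v∈S = ∈-fromDec⁺ (image? S) (subst (_∈ S) (sym (fs v)) v∈S , cong s (fs v))

  image-⊥ : image ⊥ ≡ ⊥
  image-⊥ = Empty-unique λ (u , u∈) → ∉⊥ (proj₁ (∈-fromDec⁻ (image? ⊥) u∈))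

  -- Holds because `s` is injective. Together with `image-∩` it turns the recurrence of `G` into one
  -- indexed by vertex sets of `H`.
  image-- : ∀ S v → image S - s v ≡ image (S - v)
  image-- S v = ⊆-antisym to from
    where
    to : image S - s v ⊆ image (S - v)
    to {u} u∈ with x∈p-y⁻ (image S) (s v) u∈
    ... | u∈im , u≢sv with ∈-fromDec⁻ (image? S) u∈im
    ...   | fu∈S , sfu≡u = ∈-fromDec⁺ (image? (S - v))
      (x∈p∧x≢y⇒x∈p-y fu∈S (λ fu≡v → u≢sv (trans (sym sfu≡u) (cong s fu≡v))) , sfu≡u)
    from : image (S - v) ⊆ image S - s v
    from {u} u∈ with ∈-fromDec⁻ (image? (S - v)) u∈
    ... | fu∈ , sfu≡u with x∈p-y⁻ S v fu∈
    ...   | fu∈S , fu≢v = x∈p∧x≢y⇒x∈p-y (∈-fromDec⁺ (image? S) (fu∈S , sfu≡u))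
      λ u≡sv → fu≢v (trans (cong f u≡sv) (fs v))

  image-∩ : ∀ S v → image S ∩ neighbours G (s v) ≡ image (S ∩ pulled v)
  image-∩ S v = ⊆-antisym to from
    where
    to : image S ∩ neighbours G (s v) ⊆ image (S ∩ pulled v)
    to {u} u∈ with x∈p∩q⁻ (image S) _ u∈
    ... | u∈im , u∈N with ∈-fromDec⁻ (image? S) u∈im
    ...   | fu∈S , sfu≡u = ∈-fromDec⁺ (image? (S ∩ pulled v)) (x∈p∩q⁺ (fu∈S ,
      ∈-fromDec⁺ (λ w → edge? G (s v) (s w)) (subst (Edge G (s v)) (sym sfu≡u) (∈-fromDec⁻ (edge? G (s v)) u∈N))) , sfu≡u)
    from : image (S ∩ pulled v) ⊆ image S ∩ neighbours G (s v)
    from {u} u∈ with ∈-fromDec⁻ (image? (S ∩ pulled v)) u∈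
    ... | fu∈ , sfu≡u with x∈p∩q⁻ S (pulled v) fu∈
    ...   | fu∈S , fu∈N = x∈p∩q⁺ (∈-fromDec⁺ (image? S) (fu∈S , sfu≡u) ,
      ∈-fromDec⁺ (edge? G (s v)) (subst (Edge G (s v)) sfu≡u (∈-fromDec⁻ (λ w → edge? G (s v) (s w)) fu∈N)))

  -- Passing from the pulled-back graph to `H` only adds edges, and `y′` is nearer to 0, so
  -- `Comparison` applies with positivity inherited from the good point `y`.
  cliqueSum-image-≤ : ∀ {y y′} → y ≤ y′ → y′ ≤ 0ℚ → Good G B-G y →
    cliqueSum G (image B-H) y ≤ cliqueSum H B-H y′
  cliqueSum-image-≤ {y} {y′} y≤y′ y′≤0 good = Comparison.P≤P′ {P = P} {N = pulled} rec
    (cliqueSum-recurrence H B-H y′) pulled⊆ (v∉neighbours H B-H) y≤y′ y′≤0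
    (trans (cong (λ S → cliqueSum G S y) image-⊥) (cliqueSum-⊥ G y)) (cliqueSum-⊥ H y′)
    (λ S S⊆B → good (image S) (image⊆ S⊆B)) B-H ⊆-refl
    where
    P : Subset m → ℚ
    P S = cliqueSum G (image S) y
    rec : Recurrence P pulled y
    rec S v v∈S = trans (cliqueSum-step G y (s∈image v∈S))
      (cong₂ (λ S T → cliqueSum G S y + y * cliqueSum G T y) (image-- S v) (image-∩ S v))
    pulled⊆ : ∀ v → pulled v ⊆ neighbours H v
    pulled⊆ v {u} u∈ = ∈-fromDec⁺ (edge? H v)
      (subst₂ (Edge H) (fs v) (fs u) (hom (∈-fromDec⁻ (λ w → edge? G (s v) (s w)) u∈)))

  -- The fixed positive number `c` bounds the polynomial of `H` from below at all late terms of `z`,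
  -- so these values cannot tend to 0.
  good⇒¬eventually≥ : ∀ {y z} → Good G B-G y → IsNegativeRoot H B-H z →
    ∀ N → ¬ (∀ k → N ℕ.≤ k → y ≤ seq z k)
  good⇒¬eventually≥ {y} {z} good ((ε , 0<ε , N₁ , neg) , vanishes) N y≤z = ℚ.<-irrefl refl (begin-strict
    c                                      ≤⟨ cliqueSum-image-≤ (y≤z k N≤k) z≤0 good ⟩
    cliqueSum H B-H (seq z k)              ≡⟨ seq-cliquePolynomial H B-H z k ⟨
    seq (cliquePolynomial H B-H z) k       ≡⟨ ℚ.+-identityʳ _ ⟨
    seq (cliquePolynomial H B-H z) k -ℚ 0ℚ ≤⟨ p≤∣p∣ _ ⟩
    ℚ.∣ seq (cliquePolynomial H B-H z) k -ℚ 0ℚ ∣ <⟨ small k N₂≤k ⟩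
    c                                      ∎)
    where
    open ℚ.≤-Reasoning
    c : ℚ
    c = cliqueSum G (image B-H) y
    0<c : 0ℚ < c
    0<c = good (image B-H) (image⊆ ⊆-refl)
    N₂ = proj₁ (vanishes c 0<c)
    small = proj₂ (vanishes c 0<c)
    k : ℕ
    k = N ℕ.⊔ (N₁ ℕ.⊔ N₂)
    N≤k : N ℕ.≤ k
    N≤k = ℕ.m≤m⊔n N (N₁ ℕ.⊔ N₂)
    N₁₂≤k : N₁ ℕ.⊔ N₂ ℕ.≤ k
    N₁₂≤k = ℕ.m≤n⊔m N (N₁ ℕ.⊔ N₂)
    N₂≤k : N₂ ℕ.≤ k
    N₂≤k = ℕ.≤-trans (ℕ.m≤n⊔m N₁ N₂) N₁₂≤k
    z≤0 : seq z k ≤ 0ℚ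
    z≤0 = begin
      seq z k         ≡⟨ ℚ.+-identityʳ _ ⟨
      seq z k + 0ℚ    ≤⟨ ℚ.+-monoʳ-≤ (seq z k) (ℚ.<⇒≤ 0<ε) ⟩
      seq z k + ε     ≤⟨ ℚ.<⇒≤ (neg k (ℕ.≤-trans (ℕ.m≤m⊔n N₁ N₂) N₁₂≤k)) ⟩
      0ℚ              ∎

-- Cauchy estimates, the section and the conclusion

-- Turns x ≤ a < b into a statement about one rational term of `x`. For the bisection root that term
-- is a good point.
eventually-below : ∀ {a b x} → a <ᴿ b → x ≤ᴿ a → ∃ λ N → ∀ k → N ℕ.≤ k → seq x N ≤ seq b k
eventually-below {a} {b} {x} (ε , 0<ε , N₀ , a+ε<b) x≤a = N , below
  where
  open ℚ.≤-Reasoning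
  open +-*-Solver
  -- The gap `ε` is split into four: three parts bound the excess of `x` over `a` at `N`, and one
  -- absorbs the oscillation of `b`.
  e : ℚ
  e = ½ * (½ * ε)
  0<e : 0ℚ < e
  0<e = CauchyProperties.half-pos (CauchyProperties.half-pos 0<ε)
  4e≡ε : (e + e) + (e + e) ≡ ε
  4e≡ε = trans
    (cong₂ _+_ (CauchyProperties.half+half (½ * ε)) (CauchyProperties.half+half (½ * ε)))
    (CauchyProperties.half+half ε)
  Na = proj₁ (cauchy a e 0<e)
  Nb = proj₁ (cauchy b e 0<e)
  Nx = proj₁ (cauchy x e 0<e)
  N : ℕ
  N = (N₀ ℕ.⊔ Na) ℕ.⊔ (Nb ℕ.⊔ Nx)
  N₀a≤N : N₀ ℕ.⊔ Na ℕ.≤ N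
  N₀a≤N = ℕ.m≤m⊔n _ (Nb ℕ.⊔ Nx)
  Nbx≤N : Nb ℕ.⊔ Nx ℕ.≤ N
  Nbx≤N = ℕ.m≤n⊔m (N₀ ℕ.⊔ Na) _
  N₀≤N : N₀ ℕ.≤ N
  N₀≤N = ℕ.≤-trans (ℕ.m≤m⊔n N₀ Na) N₀a≤N
  Na≤N : Na ℕ.≤ N
  Na≤N = ℕ.≤-trans (ℕ.m≤n⊔m N₀ Na) N₀a≤N
  Nb≤N : Nb ℕ.≤ N
  Nb≤N = ℕ.≤-trans (ℕ.m≤m⊔n Nb Nx) Nbx≤N
  Nx≤N : Nx ℕ.≤ N
  Nx≤N = ℕ.≤-trans (ℕ.m≤n⊔m Nb Nx) Nbx≤N
  close : ∀ {s N′ i j} → (∀ i j → N′ ℕ.≤ i → N′ ℕ.≤ j → ℚ.∣ s i -ℚ s j ∣ < e) →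
    N′ ℕ.≤ N → N ℕ.≤ i → N ℕ.≤ j → s i < s j + e
  close {i = i} {j} h N′≤N N≤i N≤j = ∣p-q∣<e⇒p<q+e (h i j (ℕ.≤-trans N′≤N N≤i) (ℕ.≤-trans N′≤N N≤j))
  xN≤aN+3e : seq x N ≤ seq a N + (e + e + e)
  -- A larger excess at `N` would survive the oscillation of `x` and `a`, leaving a gap of at least
  -- `e` at all later indices, that is `a <ᴿ x`.
  xN≤aN+3e = ℚ.≮⇒≥ λ lt → x≤a (e , 0<e , N , λ k N≤k → ℚ.≰⇒> λ x≤ → ℚ.<-irrefl refl (begin-strict
    seq x N                  <⟨ close {s = seq x} (proj₂ (cauchy x e 0<e)) Nx≤N ℕ.≤-refl N≤k ⟩
    seq x k + e              ≤⟨ ℚ.+-monoˡ-≤ e x≤ ⟩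
    seq a k + e + e
      <⟨ ℚ.+-monoˡ-< e (ℚ.+-monoˡ-< e (close {s = seq a} (proj₂ (cauchy a e 0<e)) Na≤N N≤k ℕ.≤-refl)) ⟩
    seq a N + e + e + e      ≡⟨ solve 2 (λ a e → a :+ e :+ e :+ e := a :+ (e :+ e :+ e)) refl (seq a N) e ⟩
    seq a N + (e + e + e)    <⟨ lt ⟩
    seq x N                  ∎))
  below : ∀ k → N ℕ.≤ k → seq x N ≤ seq b k
  below k N≤k = begin
    seq x N                            ≤⟨ xN≤aN+3e ⟩
    seq a N + (e + e + e)
      ≡⟨ solve 2 (λ a e → a :+ (e :+ e :+ e) := (a :+ ((e :+ e) :+ (e :+ e))) :- e) refl (seq a N) e ⟩
    (seq a N + ((e + e) + (e + e))) -ℚ e ≡⟨ cong (λ z → (seq a N + z) -ℚ e) 4e≡ε ⟩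
    (seq a N + ε) -ℚ e                 ≤⟨ ℚ.+-monoˡ-≤ (-ℚ e) (ℚ.<⇒≤ (a+ε<b N N₀≤N)) ⟩
    seq b N -ℚ e
      ≤⟨ ℚ.+-monoˡ-≤ (-ℚ e) (ℚ.<⇒≤ (close {s = seq b} (proj₂ (cauchy b e 0<e)) Nb≤N ℕ.≤-refl N≤k)) ⟩
    (seq b k + e) -ℚ e                 ≡⟨ solve 2 (λ b e → (b :+ e) :- e := b) refl (seq b k) e ⟩
    seq b k                            ∎

-- For a vertex of `B` the preimage comes from f(A) = B, and elsewhere from surjectivity.
section : ∀ {f : Fin n → Fin m} {A B} → Surjective _≡_ _≡_ f → IsImage f A B →
  ∃ λ (s : Fin m → Fin n) → (∀ v → f (s v) ≡ v) × (∀ {v} → v ∈ B → s v ∈ A)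
section {f = f} {A} {B} surj isImage =
  (λ v → proj₁ (pick v)) , (λ v → proj₁ (proj₂ (pick v))) , λ {v} → proj₂ (proj₂ (pick v))
  where
  pick : ∀ v → ∃ λ u → f u ≡ v × (v ∈ B → u ∈ A)
  pick v with v ∈? B
  ... | yes v∈B = let u , u∈A , fu≡v = Equivalence.to (isImage v) v∈B in u , fu≡v , λ _ → u∈A
  ... | no  v∉B = let u , fu≡v = surj v in u , fu≡v refl , λ v∈B → contradiction v∈B v∉B

theorem4p3 : ∀ {n m : ℕ} (G : Graph n) (H : Graph m)
    (B-G : Subset n) (B-H : Subset m) (f : Fin n → Fin m) →
    IsHomomorphism G H f →
    Surjective _≡_ _≡_ f →
    IsImage f B-G B-H →
    ∀ (z-G z-H : ℝ₋∞) →
    Isζ G B-G z-G →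
    Isζ H B-H z-H →
    z-H ≤₋∞ z-G
theorem4p3 G H B-G B-H f hom surj isImage z-G ⊥₋ _ _ = ⊥₋≤ z-G
theorem4p3 G H B-G B-H f hom surj isImage z-G [ z ] ζG (z-root , _) = compare z-G ζG
  where
  s = section surj isImage
  B-G≢∅ : Nonempty B-G
  B-G≢∅ = let v , v∈B = negativeRoot⇒nonempty H B-H z z-root in proj₁ s v , proj₂ (proj₂ s) v∈B
  open Root G B-G B-G≢∅ using (root; isRoot; good-root)
  open Section G H {B-G} {B-H} hom (proj₁ s) (proj₁ (proj₂ s)) (proj₂ (proj₂ s))
  compare : ∀ z-G → Isζ G B-G z-G → [ z ] ≤₋∞ z-G
  -- The bisection root rules out the value -∞ for `G`.
  compare ⊥₋    no-root       = ⊥-elim (no-root root isRoot)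
  -- Maximality of `w` puts the bisection root at or below it. If `w <ᴿ z`, some good term of that
  -- root would lie below all late terms of `z`.
  compare [ w ] (_ , largest) = [ (λ w<z →
    let N , root≤z = eventually-below {w} {z} {root} w<z (largest root isRoot)
    in good⇒¬eventually≥ {seq root N} {z} (good-root N) z-root N root≤z) ]≤
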